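{- Let $d \ge 3$ be a fixed integer and let $k = k(n)$ be a function $\mathbb{N}\to\mathbb{N}$ with $k(n) \le n/(\log n)^{\omega(1)}$ (that is, there is a function $h(n) \to \infty$ with $k(n) \le n/(\log n)^{h(n)}$ for all sufficiently large $n$). Then $\mathsf{D}^{\mathsf{THD}_{k(n)}}(\mathsf{IIP}_d^n) = (\log n)^{\omega(1)}$ (that is, there is a function $g(n)\to\infty$ with $\mathsf{D}^{\mathsf{THD}_{k(n)}}(\mathsf{IIP}_d^n) \ge (\log n)^{g(n)}$ for all sufficiently large $n$). In particular, when $k$ is a constant, $\mathsf{D}^{\mathsf{THD}_k}(\mathsf{IIP}_d^n) = \Omega(n/\log n)$ as $n\to\infty$.
   Context: For an integer $k \ge 0$, the threshold $k$-Hamming Distance problem is $\mathsf{THD}_k = (\mathsf{THD}_k^m)_{m\in\mathbb{N}}$, where $\mathsf{THD}_k^m$ is the $2^m \times 2^m$ Boolean matrix with rows and columns indexed by $\{0,1\}^m$ and $\mathsf{THD}_k^m(x,y) = 1$ if and only if the Hamming distance of $x,y$ is at most $k$. For fixed $d$, the Integer Inner Product problem is $\mathsf{IIP}_d = (\mathsf{IIP}_d^n)_{n\in\mathbb{N}}$, where $\mathsf{IIP}_d^n$ is the $2^{dn}\times 2^{dn}$ Boolean matrix with rows and columns indexed by $\{0,1\}^{dn}$; $x,y \in \{0,1\}^{dn}$ are interpreted as binary ($n$ bits per coordinate, two's complement) representations of integer vectors $x=(x_1,\dots,x_d)$, $y=(y_1,\dots,y_d)$ with coordinates in $\{ -2^{n-1},\dots,2^{n-1}-1\}$,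 and $\mathsf{IIP}_d^n(x,y) = 0$ if $\langle x,y\rangle = \sum_i x_i y_i = 0$, and $1$ otherwise. For a set $\mathcal{M}$ of Boolean matrices (a communication problem, i.e. a sequence of square Boolean matrices, is also regarded as the set of its matrices, here $\{\mathsf{THD}_k^m : m \in \mathbb{N}\}$ with $m$ unrestricted), the query set $\mathsf{QS}(\mathcal{M})$ is the set of all matrices obtained from matrices in $\mathcal{M}$ by the operations: arbitrary row and column permutations; taking arbitrary submatrices; duplicating arbitrary rows or columns. For $P \in \{0,1\}^{N \times N}$, a deterministic communication protocol with oracle access to $\mathcal{M}$ is a binary tree in which each inner node $v$ is associated with an $N \times N$ matrix $Q_v \in \mathsf{QS}(\mathcal{M})$ (with the same row and column index sets as $P$) and each leaf $\ell$ with a bit $b_\ell \in \{0,1\}$. An input $(x,y)$ defines a root-to-leaf path: at node $v$ the entry $Q_v(x,y)$ decides whether to go left or right; the output is the bit of the leaf reached. The protocol computes $P$ if the output is $P(x,y)$ for every $(x,y)$. Its cost is the depth of the tree, and $\mathsf{D}^{\mathcal{M}}(P)$ is the minimum cost of such a protocol computing $P$ ($\infty$ if there is none). -}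

module Defs where

open import Data.Bool using (Bool; true; false; not; if_then_else_)
import Data.Bool as Bool
open import Data.Integer as ℤ using (ℤ; 0ℤ; +_)
open import Data.Maybe using (Maybe; maybe′)
open import Data.Nat using (ℕ; zero; suc; _+_; _*_; _^_; _≤_; _≤?_; _⊔_)
open import Data.Nat.Logarithm using (⌊log₂_⌋)
open import Data.Product using (∃; ∃-syntax; _×_; proj₁; proj₂)
open import Data.Vec using (Vec; []; _∷_; count; foldr′; group; map; zip; zipWith)
open import Function.Bundles using (_↔_; _↣_; Inverse; Injection)
open import Relation.Binary.PropositionalEquality using (_≡_)
open import Relation.Nullary using (does; ¬?)

private
  variable
    R C R′ C′ X : Set

------------------------------------------------------------------------
-- Boolean matrices and communication problems

Matrix : Set → Set → Set
Matrix R C = R → C → Bool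

record Problem : Set₁ where
  field
    Index  : ℕ → Set
    matrix : ∀ n → Matrix (Index n) (Index n)

open Problem public

Word : ℕ → Set
Word n = Vec Bool n

hamming : ∀ {m} → Word m → Word m → ℕ
hamming x y = count (λ p → ¬? (proj₁ p Bool.≟ proj₂ p)) (zip x y)

THD : ℕ → Problem
THD k = record
  { Index  = Word
  ; matrix = λ m x y → does (hamming x y ≤? k)
  }

bit : Bool → ℕ
bit b = if b then 1 else 0

-- Most significant bit first.
unsigned : ∀ {n} → Word n → ℕ
unsigned []               = 0
unsigned {suc n} (b ∷ bs) = bit b * 2 ^ n + unsigned bs

-- Two's complement: the leading bit of an (n+1)-bit word has weight -2ⁿ.
-- The empty word (0 bits) is read as 0.
signed : ∀ {n} → Word n → ℤ
signed []               = 0ℤ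
signed {suc n} (s ∷ bs) = + unsigned bs ℤ.- + (bit s * 2 ^ n)

-- Cuts the word into d consecutive blocks of n bits.
decode : ∀ d n → Word (d * n) → Vec ℤ d
decode d n x = map signed (proj₁ (group d n x))

⟨_,_⟩ : ∀ {d} → Vec ℤ d → Vec ℤ d → ℤ
⟨ u , v ⟩ = foldr′ ℤ._+_ 0ℤ (zipWith ℤ._*_ u v)

IIP : ℕ → Problem
IIP d = record
  { Index  = λ n → Word (d * n)
  ; matrix = λ n x y → not (does (⟨ decode d n x , decode d n y ⟩ ℤ.≟ 0ℤ))
  }

------------------------------------------------------------------------
-- Query sets

-- Index sets are arbitrary types, so `permute` also renames indices.
-- A duplicated row (column) receives the fresh index `nothing`.
-- `resp` replaces function extensionality: matrices count as equal when
-- their entries agree.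
data QS (𝓜 : Problem) : {R C : Set} → Matrix R C → Set₁ where
  base      : ∀ n → QS 𝓜 (matrix 𝓜 n)
  permute   : {Q : Matrix R C} (σ : R′ ↔ R) (τ : C′ ↔ C) → QS 𝓜 Q →
              QS 𝓜 (λ x y → Q (Inverse.to σ x) (Inverse.to τ y))
  submatrix : {Q : Matrix R C} (f : R′ ↣ R) (g : C′ ↣ C) → QS 𝓜 Q →
              QS 𝓜 (λ x y → Q (Injection.to f x) (Injection.to g y))
  dupRow    : {Q : Matrix R C} (i : R) → QS 𝓜 Q →
              QS 𝓜 {Maybe R} {C} (λ x y → Q (maybe′ (λ r → r) i x) y)
  dupCol    : {Q : Matrix R C} (j : C) → QS 𝓜 Q →
              QS 𝓜 {R} {Maybe C} (λ x y → Q x (maybe′ (λ c → c) j y))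
  resp      : {Q Q′ : Matrix R C} → (∀ x y → Q x y ≡ Q′ x y) →
              QS 𝓜 Q → QS 𝓜 Q′

------------------------------------------------------------------------
-- Deterministic protocols with oracle access to 𝓜

data Protocol (𝓜 : Problem) (X : Set) : Set₁ where
  leaf : Bool → Protocol 𝓜 X
  node : (Q : Matrix X X) → QS 𝓜 Q → (left right : Protocol 𝓜 X) →
         Protocol 𝓜 X

run : ∀ {𝓜} → Protocol 𝓜 X → X → X → Bool
run (leaf b)       x y = b
run (node Q _ l r) x y = if Q x y then run r x y else run l x y

cost : ∀ {𝓜} → Protocol 𝓜 X → ℕ
cost (leaf _)       = 0
cost (node _ _ l r) = suc (cost l ⊔ cost r)

Computes : ∀ {𝓜} → Protocol 𝓜 X → Matrix X X → Set
Computes T P = ∀ x y → run T x y ≡ P x y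

-- D[ 𝓜 ] P ≐ c says that the minimum cost exists and equals c; no c
-- satisfies it when no protocol computes P (minimum ∞).  A lower bound
-- b ≤ D is therefore stated as ∀ c → D[ 𝓜 ] P ≐ c → b ≤ c, with the case
-- of ∞ being trivial.  Nothing is lost by not having the minimum as a
-- function: by well-founded induction on costs, this is constructively
-- equivalent to b ≤ cost T for every T that computes P.
record D[_]_≐_ (𝓜 : Problem) (P : Matrix X X) (c : ℕ) : Set₁ where
  field
    attained : ∃[ T ] Computes {𝓜 = 𝓜} T P × cost T ≡ c
    minimal  : ∀ (T : Protocol 𝓜 X) → Computes T P → c ≤ cost T

------------------------------------------------------------------------
-- Asymptotics

Eventually : ∀ {ℓ} → (ℕ → Set ℓ) → Set ℓ
Eventually A = ∃[ N ] ∀ n → N ≤ n → A n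

_→∞ : (ℕ → ℕ) → Set
h →∞ = ∀ B → Eventually λ n → B ≤ h n

-- Exponent functions tending to infinity may be taken ℕ-valued, and log n
-- may be replaced by ⌊log₂ n⌋: the integer part of a function tending to
-- infinity tends to infinity, and ⌊log₂ n⌋ ≤ log₂ n ≤ ⌊log₂ n⌋² for n ≥ 4,
-- so the change only rescales an exponent by a bounded factor.
-- k(n) ≤ n / (log n)^ω(1) is written without division.
_≤n/log^ω1 : (ℕ → ℕ) → Set
k ≤n/log^ω1 =
  ∃[ h ] h →∞ × Eventually λ n → k n * ⌊log₂ n ⌋ ^ h n ≤ n

{-# OPTIONS --safe #-}
-- The zeros of IIP₃ contain a point–line incidence graph with 2^s values for
-- each slope and abscissa: it has no K₂₂, yet S⁴ edges on 3S³ vertices, S = 2^s.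
-- Conversely, a protocol of cost c whose zeros are K₂₂-free on A × B has at most
-- W^c (|A| + |B|) of them.  At a leaf this holds because a K₂₂-free rectangle is
-- thin.  At a node, the 1-entries of THD k (and likewise its 0-entries) are
-- fractionally covered by blocky matrices: if pairs sharing a key are 1-entries,
-- each row and column has at most M keys and each 1-entry shares at least M / W
-- keys, then the induction hypothesis on the blocks loses only a factor W.
--
-- Keys for distance > k: parities of k + 1 random bins of coordinates, where
-- sharing a key means having opposite parities in each bin.
-- Keys for distance ≤ k: both words move to a common centre by flips towards the
-- majority, bit by bit; a word that declines such a flip halves the list of
-- competing words, so it reaches few centres although the word length is
-- unbounded.
--
-- Hence W = n^O(k), and 2^s ≤ 3 W^c gives n = O(k c log n).
module Submission where

open import Defs
open import Data.Bool using (Bool; true; false; not; _∧_; _∨_; if_then_else_)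
import Data.Bool as Bool
open import Data.Bool.Properties using (∧-zeroʳ; ¬-not; not-involutive)
open import Data.Fin using (Fin; zero; suc; toℕ; fromℕ<)
open import Data.Fin.Properties using (toℕ<n; toℕ-fromℕ<; toℕ-injective)
open import Data.Integer as ℤ using (ℤ; 0ℤ; 1ℤ; -1ℤ)
import Data.Integer.Properties as ℤ
import Data.Integer.Tactic.RingSolver as ℤ-Solver
open import Data.List using (List; []; _∷_; _++_; map; length; cartesianProduct; cartesianProductWith; upTo; allFin)
open import Data.List.Membership.Propositional using (_∈_)
open import Data.List.Membership.Propositional.Properties
open import Data.List.Properties using (length-map; length-++; length-upTo; length-tabulate)
open import Data.List.Relation.Unary.All as All using ([]; _∷_)
open import Data.List.Relation.Unary.AllPairs using ([]; _∷_)
open import Data.List.Relation.Unary.Any using (here; there)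
open import Data.List.Relation.Unary.Unique.Propositional using (Unique)
import Data.List.Relation.Unary.Unique.Propositional.Properties as Unique
open import Data.Nat using (ℕ; zero; suc; _+_; _*_; _∸_; _^_; _≤_; _<_; z≤n; s≤s; _⊔_; _⊓_; _≤?_; NonZero; >-nonZero; >-nonZero⁻¹; ⌊_/2⌋; ⌈_/2⌉)
open import Data.Nat.Logarithm using (⌊log₂_⌋; ⌊log₂⌋-mono-≤; ⌊log₂⌊n/2⌋⌋≡⌊log₂n⌋∸1; ⌊log₂[2^n]⌋≡n)
open import Data.Nat.Properties
open import Data.Nat.Tactic.RingSolver using (solve-∀)
open import Data.Product using (∃-syntax; _×_; _,_; proj₁; proj₂)
open import Data.Sum using (_⊎_; inj₁; inj₂)
open import Data.Vec as Vec using (Vec; []; _∷_; tail; replicate; updateAt; concat; group)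
import Data.Vec.Properties as Vec
open import Function using (_∘_)
open import Relation.Binary.PropositionalEquality
open import Relation.Nullary using (¬_; yes; no; contradiction; does; Dec)
open import Relation.Nullary.Decidable using (dec-true; dec-false)

-- Finite sums and rectangles

private
  variable
    A B C Key : Set

∑ : List A → (A → ℕ) → ℕ
∑ []       f = 0
∑ (x ∷ xs) f = f x + ∑ xs f

infix 5 ∑
syntax ∑ xs (λ x → e) = ∑[ x ∈ xs ] e

∑-mono : ∀ (xs : List A) {f g : A → ℕ} → (∀ {x} → x ∈ xs → f x ≤ g x) → ∑ xs f ≤ ∑ xs g
∑-mono []       f≤g = z≤n
∑-mono (x ∷ xs) f≤g = +-mono-≤ (f≤g (here refl)) (∑-mono xs (f≤g ∘ there))

∑-cong : ∀ (xs : List A) {f g : A → ℕ} → (∀ x → f x ≡ g x) → ∑ xs f ≡ ∑ xs g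
∑-cong []       f≡g = refl
∑-cong (x ∷ xs) f≡g = cong₂ _+_ (f≡g x) (∑-cong xs f≡g)

∑-+ : ∀ (xs : List A) (f g : A → ℕ) → ∑[ x ∈ xs ] (f x + g x) ≡ ∑ xs f + ∑ xs g
∑-+ []       f g = refl
∑-+ (x ∷ xs) f g rewrite ∑-+ xs f g = interchange (f x) (g x) (∑ xs f) (∑ xs g)
  where
  interchange : ∀ a b c d → a + b + (c + d) ≡ a + c + (b + d)
  interchange = solve-∀

∑-*ˡ : ∀ c (xs : List A) (f : A → ℕ) → ∑[ x ∈ xs ] (c * f x) ≡ c * ∑ xs f
∑-*ˡ c []       f = sym (*-zeroʳ c)
∑-*ˡ c (x ∷ xs) f rewrite ∑-*ˡ c xs f = sym (*-distribˡ-+ c (f x) (∑ xs f))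

∑-const : ∀ (xs : List A) c → ∑[ _ ∈ xs ] c ≡ length xs * c
∑-const []       c = refl
∑-const (x ∷ xs) c = cong (c +_) (∑-const xs c)

∑-zero : ∀ (xs : List A) → ∑[ _ ∈ xs ] 0 ≡ 0
∑-zero xs = trans (∑-const xs 0) (*-zeroʳ (length xs))

∑-swap : ∀ (xs : List A) (ys : List B) (f : A → B → ℕ) →
         ∑[ x ∈ xs ] ∑[ y ∈ ys ] f x y ≡ ∑[ y ∈ ys ] ∑[ x ∈ xs ] f x y
∑-swap []       ys f = sym (∑-zero ys)
∑-swap (x ∷ xs) ys f rewrite ∑-swap xs ys f = sym (∑-+ ys (f x) _)

∑-++ : ∀ (xs ys : List A) (f : A → ℕ) → ∑ (xs ++ ys) f ≡ ∑ xs f + ∑ ys f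
∑-++ []       ys f = refl
∑-++ (x ∷ xs) ys f rewrite ∑-++ xs ys f = sym (+-assoc (f x) _ _)

∑-map : ∀ (g : A → B) (xs : List A) (f : B → ℕ) → ∑ (map g xs) f ≡ ∑ xs (f ∘ g)
∑-map g []       f = refl
∑-map g (x ∷ xs) f = cong (f (g x) +_) (∑-map g xs f)

∑-cartesianProductWith : ∀ (_∙_ : A → B → C) (xs : List A) (ys : List B) (f : C → ℕ) →
  ∑ (cartesianProductWith _∙_ xs ys) f ≡ ∑[ x ∈ xs ] ∑[ y ∈ ys ] f (x ∙ y)
∑-cartesianProductWith _∙_ []       ys f = refl
∑-cartesianProductWith _∙_ (x ∷ xs) ys f = trans
  (∑-++ (map (x ∙_) ys) (cartesianProductWith _∙_ xs ys) f)
  (cong₂ _+_ (∑-map (x ∙_) ys f) (∑-cartesianProductWith _∙_ xs ys f))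

∈⇒≤∑ : ∀ {xs : List A} {x} (f : A → ℕ) → x ∈ xs → f x ≤ ∑ xs f
∈⇒≤∑ f (here refl) = m≤m+n _ _
∈⇒≤∑ f (there x∈)  = ≤-trans (∈⇒≤∑ f x∈) (m≤n+m _ _)

bit-∧ : ∀ a b → bit (a ∧ b) ≡ bit a * bit b
bit-∧ false b = refl
bit-∧ true  b = sym (+-identityʳ (bit b))

bit≤1 : ∀ b → bit b ≤ 1
bit≤1 false = z≤n
bit≤1 true  = s≤s z≤n

bit-mono : ∀ {a b} → (a ≡ true → b ≡ true) → bit a ≤ bit b
bit-mono {false} h = z≤n
bit-mono {true}  h rewrite h refl = s≤s z≤n

∧⁻ : ∀ {a b} → a ∧ b ≡ true → a ≡ true × b ≡ true
∧⁻ {true} {true} _ = refl , refl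

∧⁺ : ∀ {a b} → a ≡ true → b ≡ true → a ∧ b ≡ true
∧⁺ refl refl = refl

*-bit≤ : ∀ c a {n} → (a ≡ true → c ≤ n) → c * bit a ≤ n
*-bit≤ c false h = ≤-trans (≤-reflexive (*-zeroʳ c)) z≤n
*-bit≤ c true  h = ≤-trans (≤-reflexive (*-identityʳ c)) (h refl)

size : List A → (A → Bool) → ℕ
size xs α = ∑[ x ∈ xs ] bit (α x)

size-zero : ∀ (xs : List A) {α} → (∀ {x} → x ∈ xs → α x ≡ false) → size xs α ≡ 0
size-zero []       h = refl
size-zero (x ∷ xs) h = cong₂ _+_ (cong bit (h (here refl))) (size-zero xs (h ∘ there))

0<size : ∀ (xs : List A) {α} → 0 < size xs α → ∃[ x ] x ∈ xs × α x ≡ true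
0<size (x ∷ xs) {α} 0< with α x in eq
... | true  = x , here refl , eq
... | false = let y , y∈ , αy = 0<size xs 0< in y , there y∈ , αy

1<size : ∀ {xs : List A} {α} → Unique xs → 1 < size xs α →
         ∃[ x ] ∃[ y ] x ≢ y × α x ≡ true × α y ≡ true
1<size {xs = x ∷ xs} {α} (x∉ ∷ xs!) 1< with α x in eq
... | true  = let y , y∈ , αy = 0<size xs (≤-pred 1<)
              in x , y , All.lookup x∉ y∈ , eq , αy
... | false = 1<size xs! 1<

size≤1 : ∀ {xs : List A} {α} → Unique xs →
         (∀ {x y} → α x ≡ true → α y ≡ true → x ≡ y) → size xs α ≤ 1
size≤1 {xs = xs} {α} xs! h with size xs α ≤? 1
... | yes p = p
... | no ¬p =
  let x , y , x≢y , αx , αy = 1<size xs! (≰⇒> ¬p) in contradiction (h αx αy) x≢y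

-- A rectangle is a pair of predicates α, β on fixed lists of rows and columns.
module Rectangle (rows : List A) (cols : List B) where

  pairs : (A → Bool) → (B → Bool) → (A → B → Bool) → ℕ
  pairs α β w = ∑[ r ∈ rows ] ∑[ c ∈ cols ] bit (α r ∧ β c ∧ w r c)

  perimeter : (A → Bool) → (B → Bool) → ℕ
  perimeter α β = size rows α + size cols β

  infix 4 _⊆_
  _⊆_ : ∀ {X : Set} → (X → Bool) → (X → Bool) → Set
  α′ ⊆ α = ∀ x → α′ x ≡ true → α x ≡ true

  _⊠_⊆_ : (A → Bool) → (B → Bool) → (A → B → Bool) → Set
  α ⊠ β ⊆ P = ∀ r c → α r ≡ true → β c ≡ true → P r c ≡ true

  -- The effect on counting of a fractional cover by rectangles inside `P`, recorded in place of the
  -- cover itself: the ones and the zeros of a query are covered through different kinds of keys,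
  -- and the induction over protocols needs only this effect. There `w` marks the zeros of the
  -- protocol.
  Coverable : (A → B → Bool) → ℕ → Set
  Coverable P W = ∀ w α β K →
    (∀ α′ β′ → α′ ⊆ α → β′ ⊆ β → α′ ⊠ β′ ⊆ P → pairs α′ β′ w ≤ K * perimeter α′ β′) →
    pairs α β (λ r c → P r c ∧ w r c) ≤ W * (K * perimeter α β)

  pairs-mono : ∀ {α β w w′} → (∀ r c → α r ≡ true → β c ≡ true → w r c ≡ true → w′ r c ≡ true) →
               pairs α β w ≤ pairs α β w′
  pairs-mono h = ∑-mono rows λ {r} _ → ∑-mono cols λ {c} _ → bit-mono λ e →
    let αr , e′ = ∧⁻ e ; βc , wrc = ∧⁻ e′ in ∧⁺ αr (∧⁺ βc (h r c αr βc wrc))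

  pairs-split : ∀ {α β} (P : A → B → Bool) w →
    pairs α β w ≡ pairs α β (λ r c → P r c ∧ w r c) + pairs α β (λ r c → not (P r c) ∧ w r c)
  pairs-split {α} {β} P w = trans
    (∑-cong rows λ r → trans (∑-cong cols λ c → split (α r) (β c) (P r c) (w r c)) (∑-+ cols _ _))
    (∑-+ rows _ _)
    where
    split : ∀ a b p v → bit (a ∧ b ∧ v) ≡ bit (a ∧ b ∧ p ∧ v) + bit (a ∧ b ∧ not p ∧ v)
    split false b     p     v = refl
    split true  false p     v = refl
    split true  true  false v = refl
    split true  true  true  v = sym (+-identityʳ (bit v))

  pairs-full : ∀ α β → pairs α β (λ _ _ → true) ≡ size rows α * size cols β
  pairs-full α β = trans
    (∑-cong rows λ r → trans
      (∑-cong cols λ c → trans (bit-∧ (α r) _) (cong (bit (α r) *_) (trans (bit-∧ (β c) true) (*-identityʳ _))))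
      (trans (∑-*ˡ (bit (α r)) cols _) (*-comm (bit (α r)) _)))
    (trans (∑-*ˡ (size cols β) rows _) (*-comm (size cols β) _))

  coverable-resp : ∀ {P P′} W → (∀ r c → P r c ≡ P′ r c) → Coverable P W → Coverable P′ W
  coverable-resp {P} {P′} W P≡P′ cov w α β K bound = ≤-trans
    (pairs-mono {α} {β} λ r c _ _ e → trans (cong (_∧ w r c) (P≡P′ r c)) e)
    (cov w α β K λ α′ β′ α⊆ β⊆ inP → bound α′ β′ α⊆ β⊆ λ r c αr βc →
      trans (sym (P≡P′ r c)) (inP r c αr βc))

  module _ (keys : List Key) (κ : A → Key → Bool) (κ′ : B → Key → Bool)
           (P : A → B → Bool) {M W : ℕ} .{{_ : NonZero M}}
           (sound : ∀ {r c k} → κ r k ≡ true → κ′ c k ≡ true → P r c ≡ true)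
           (few   : ∀ {r} → r ∈ rows → size keys (κ r) ≤ M)
           (few′  : ∀ {c} → c ∈ cols → size keys (κ′ c) ≤ M)
           (many  : ∀ {r c} → r ∈ rows → c ∈ cols → P r c ≡ true →
                    M ≤ W * size keys (λ k → κ r k ∧ κ′ c k))
    where

    private
      -- Summed over the elements first, each element of `γ` contributes its at most `M` keys.
      restrict : ∀ {X : Set} (xs : List X) (χ : X → Key → Bool) γ →
        (∀ {x} → x ∈ xs → size keys (χ x) ≤ M) →
        ∑[ k ∈ keys ] size xs (λ x → γ x ∧ χ x k) ≤ M * size xs γ
      restrict xs χ γ few = begin
        ∑[ k ∈ keys ] ∑[ x ∈ xs ] bit (γ x ∧ χ x k)  ≡⟨ ∑-swap keys xs _ ⟩
        ∑[ x ∈ xs ] ∑[ k ∈ keys ] bit (γ x ∧ χ x k)  ≤⟨ ∑-mono xs row ⟩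
        ∑[ x ∈ xs ] (M * bit (γ x))                  ≡⟨ ∑-*ˡ M xs _ ⟩
        M * size xs γ                                ∎
        where
        open ≤-Reasoning
        row : ∀ {x} → x ∈ xs → ∑[ k ∈ keys ] bit (γ x ∧ χ x k) ≤ M * bit (γ x)
        row {x} x∈ with γ x
        ... | false = ≤-trans (≤-reflexive (∑-zero keys)) z≤n
        ... | true  = ≤-trans (few x∈) (≤-reflexive (sym (*-identityʳ M)))

    -- Double counting, with both sides multiplied by `M`. Each marked entry of `P` shares at least
    -- `M / W` keys, so it is counted that often by the blocks `αₖ k` times `βₖ k`. By `sound` these
    -- blocks lie inside `P`, so `bound` applies to each, and their perimeters add up to at most `M`
    -- times the whole perimeter.
    shared-keys⇒coverable : Coverable P W
    shared-keys⇒coverable w α β K bound = *-cancelˡ-≤ M (begin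
      M * pairs α β (λ r c → P r c ∧ w r c)
        ≡⟨ ∑-*ˡ M rows _ ⟨
      ∑[ r ∈ rows ] (M * (∑[ c ∈ cols ] bit (α r ∧ β c ∧ P r c ∧ w r c)))
        ≤⟨ ∑-mono rows (λ {r} r∈ → ≤-trans (≤-reflexive (sym (∑-*ˡ M cols _)))
             (≤-trans (∑-mono cols λ {c} c∈ → *-bit≤ M (α r ∧ β c ∧ P r c ∧ w r c) (shared r∈ c∈))
                      (≤-reflexive (∑-*ˡ W cols _)))) ⟩
      ∑[ r ∈ rows ] (W * (∑[ c ∈ cols ] ∑[ k ∈ keys ] bit (αₖ k r ∧ βₖ k c ∧ w r c)))
        ≡⟨ ∑-*ˡ W rows _ ⟩
      W * (∑[ r ∈ rows ] ∑[ c ∈ cols ] ∑[ k ∈ keys ] bit (αₖ k r ∧ βₖ k c ∧ w r c))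
        ≡⟨ cong (W *_) (trans (∑-cong rows (λ r → ∑-swap cols keys _)) (∑-swap rows keys _)) ⟩
      W * (∑[ k ∈ keys ] pairs (αₖ k) (βₖ k) w)
        ≤⟨ *-monoʳ-≤ W (∑-mono keys λ {k} _ → bound (αₖ k) (βₖ k) (λ _ → proj₁ ∘ ∧⁻) (λ _ → proj₁ ∘ ∧⁻)
             λ r c αr βc → sound (proj₂ (∧⁻ αr)) (proj₂ (∧⁻ {β c} βc))) ⟩
      W * (∑[ k ∈ keys ] (K * perimeter (αₖ k) (βₖ k)))
        ≡⟨ cong (W *_) (trans (∑-*ˡ K keys _) (cong (K *_) (∑-+ keys _ _))) ⟩
      W * (K * ((∑[ k ∈ keys ] size rows (αₖ k)) + (∑[ k ∈ keys ] size cols (βₖ k))))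
        ≤⟨ *-monoʳ-≤ W (*-monoʳ-≤ K (+-mono-≤ (restrict rows κ α few) (restrict cols κ′ β few′))) ⟩
      W * (K * (M * size rows α + M * size cols β))
        ≡⟨ rearrange W K M (size rows α) (size cols β) ⟩
      M * (W * (K * perimeter α β)) ∎)
      where
      open ≤-Reasoning
      αₖ : Key → A → Bool
      αₖ k r = α r ∧ κ r k
      βₖ : Key → B → Bool
      βₖ k c = β c ∧ κ′ c k
      rearrange : ∀ w k m a b → w * (k * (m * a + m * b)) ≡ m * (w * (k * (a + b)))
      rearrange = solve-∀
      shared : ∀ {r c} → r ∈ rows → c ∈ cols → α r ∧ β c ∧ P r c ∧ w r c ≡ true →
               M ≤ W * (∑[ k ∈ keys ] bit (αₖ k r ∧ βₖ k c ∧ w r c))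
      shared {r} {c} r∈ c∈ e =
        let αr , e₁ = ∧⁻ {α r} e ; βc , e₂ = ∧⁻ {β c} e₁ ; Prc , wrc = ∧⁻ {P r c} e₂
        in ≤-trans (many r∈ c∈ Prc) (*-monoʳ-≤ W (∑-mono keys λ {k} _ → bit-mono λ s →
             let κr , κc = ∧⁻ {κ r k} s in ∧⁺ (∧⁺ αr κr) (∧⁺ (∧⁺ βc κc) wrc)))

-- Queries as reindexed matrices, and protocols on graphs without K₂₂

-- Every operation merely renames rows and columns along maps, non-injective ones in the case of
-- duplication. Since `m` is not controlled, the covers below must cost the same for all word
-- lengths.
QS⇒reindexing : ∀ {𝓜 R C} {Q : Matrix R C} → QS 𝓜 Q →
  ∃[ m ] ∃[ f ] ∃[ g ] (∀ x y → Q x y ≡ matrix 𝓜 m (f x) (g y))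
QS⇒reindexing (base n) = n , (λ x → x) , (λ y → y) , λ _ _ → refl
QS⇒reindexing (permute σ τ q) with QS⇒reindexing q
... | m , f , g , eq = m , f ∘ _ , g ∘ _ , λ x y → eq _ _
QS⇒reindexing (submatrix σ τ q) with QS⇒reindexing q
... | m , f , g , eq = m , f ∘ _ , g ∘ _ , λ x y → eq _ _
QS⇒reindexing (dupRow i q) with QS⇒reindexing q
... | m , f , g , eq = m , f ∘ _ , g , λ x y → eq _ _
QS⇒reindexing (dupCol j q) with QS⇒reindexing q
... | m , f , g , eq = m , f , g ∘ _ , λ x y → eq _ _
QS⇒reindexing (resp h q) with QS⇒reindexing q
... | m , f , g , eq = m , f , g , λ x y → trans (sym (h x y)) (eq x y)

module _ {A B X : Set} {rows : List A} {cols : List B}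
         (rows! : Unique rows) (cols! : Unique cols)
         (Inc : A → B → Set)
         (no-K₂₂ : ∀ {r r′ c c′} → r ≢ r′ → c ≢ c′ →
                   Inc r c → Inc r c′ → Inc r′ c → ¬ Inc r′ c′)
         (f : A → X) (g : B → X)
  where
  open Rectangle rows cols

  zeros : ∀ {𝓜} → Protocol 𝓜 X → A → B → Bool
  zeros T r c = not (run T (f r) (g c))

  -- Two rows and two columns would form a K₂₂, so one side has at most one element and the area is
  -- at most the other side.
  K₂₂-free⇒thin : ∀ α β → (∀ r c → α r ≡ true → β c ≡ true → Inc r c) →
                  size rows α * size cols β ≤ perimeter α β
  K₂₂-free⇒thin α β inc with size rows α ≤? 1 | size cols β ≤? 1
  ... | yes a≤1 | _ = ≤-trans (*-monoˡ-≤ (size cols β) a≤1)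
                        (≤-trans (≤-reflexive (*-identityˡ (size cols β))) (m≤n+m _ _))
  ... | no _ | yes b≤1 = ≤-trans (*-monoʳ-≤ (size rows α) b≤1)
                        (≤-trans (≤-reflexive (*-identityʳ (size rows α))) (m≤m+n _ _))
  ... | no a≰1 | no b≰1 =
    let r , r′ , r≢r′ , αr , αr′ = 1<size rows! (≰⇒> a≰1)
        c , c′ , c≢c′ , βc , βc′ = 1<size cols! (≰⇒> b≰1)
    in contradiction (inc r′ c′ αr′ βc′)
         (no-K₂₂ r≢r′ c≢c′ (inc r c αr βc) (inc r c′ αr βc′) (inc r′ c αr′ βc))

  module _ {𝓜 : Problem} {W₁ W₀ W : ℕ} .{{_ : NonZero W}} (W₁+W₀≤W : W₁ + W₀ ≤ W)
           (ones-coverable  : ∀ {Q : Matrix X X} → QS 𝓜 Q → Coverable (λ r c → Q (f r) (g c)) W₁)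
           (zeros-coverable : ∀ {Q : Matrix X X} → QS 𝓜 Q → Coverable (λ r c → not (Q (f r) (g c))) W₀)
    where

    -- Induction on the protocol. On a rectangle where the query is constant, `T` has the zeros of
    -- one child, so the assumption that zeros are incidences passes on to that child. Coverability
    -- then assembles the entries where the query is 1 and those where it is 0, at the price
    -- `W₁ + W₀`.
    zeros-bound : ∀ (T : Protocol 𝓜 X) α β →
      (∀ r c → α r ≡ true → β c ≡ true → zeros T r c ≡ true → Inc r c) →
      pairs α β (zeros T) ≤ W ^ cost T * perimeter α β
    zeros-bound (leaf true) α β inc = ≤-trans (≤-reflexive (trans
      (∑-cong rows λ r → trans (∑-cong cols λ c → zero-weight (α r) (β c)) (∑-zero cols)) (∑-zero rows))) z≤n
      where
      zero-weight : ∀ a b → bit (a ∧ b ∧ false) ≡ 0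
      zero-weight false b     = refl
      zero-weight true  false = refl
      zero-weight true  true  = refl
    zeros-bound (leaf false) α β inc = begin
      pairs α β (λ _ _ → true)     ≡⟨ pairs-full α β ⟩
      size rows α * size cols β    ≤⟨ K₂₂-free⇒thin α β (λ r c αr βc → inc r c αr βc refl) ⟩
      perimeter α β                ≡⟨ *-identityˡ _ ⟨
      1 * perimeter α β            ∎
      where open ≤-Reasoning
    zeros-bound T@(node Q q l r) α β inc = begin
      pairs α β (zeros T)
        ≡⟨ pairs-split {α} {β} Qfg (zeros T) ⟩
      pairs α β (λ a b → Qfg a b ∧ zeros T a b) + pairs α β (λ a b → not (Qfg a b) ∧ zeros T a b)
        ≤⟨ +-mono-≤ (ones-coverable q (zeros T) α β K right) (zeros-coverable q (zeros T) α β K left) ⟩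
      W₁ * (K * perimeter α β) + W₀ * (K * perimeter α β)
        ≡⟨ *-distribʳ-+ (K * perimeter α β) W₁ W₀ ⟨
      (W₁ + W₀) * (K * perimeter α β)
        ≤⟨ *-monoˡ-≤ (K * perimeter α β) W₁+W₀≤W ⟩
      W * (K * perimeter α β)
        ≡⟨ *-assoc W K _ ⟨
      W * K * perimeter α β ∎
      where
      open ≤-Reasoning
      -- The larger depth gives one constant that is good for both children.
      K = W ^ (cost l ⊔ cost r)
      Qfg : A → B → Bool
      Qfg a b = Q (f a) (g b)
      descend : ∀ (S : Protocol 𝓜 X) → cost S ≤ cost l ⊔ cost r → ∀ α′ β′ → α′ ⊆ α → β′ ⊆ β →
        (∀ a b → α′ a ≡ true → β′ b ≡ true → zeros T a b ≡ zeros S a b) →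
        (pairs α′ β′ (zeros S) ≤ W ^ cost S * perimeter α′ β′) →
        pairs α′ β′ (zeros T) ≤ K * perimeter α′ β′
      descend S le α′ β′ α⊆ β⊆ same bound = begin
        pairs α′ β′ (zeros T)               ≤⟨ pairs-mono (λ a b αa βb → trans (sym (same a b αa βb))) ⟩
        pairs α′ β′ (zeros S)               ≤⟨ bound ⟩
        W ^ cost S * perimeter α′ β′        ≤⟨ *-monoˡ-≤ (perimeter α′ β′) (^-monoʳ-≤ W le) ⟩
        K * perimeter α′ β′                 ∎
      right : ∀ α′ β′ → α′ ⊆ α → β′ ⊆ β → α′ ⊠ β′ ⊆ Qfg → pairs α′ β′ (zeros T) ≤ K * perimeter α′ β′
      right α′ β′ α⊆ β⊆ inQ = descend r (m≤n⊔m (cost l) (cost r)) α′ β′ α⊆ β⊆ same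
        (zeros-bound r α′ β′ λ a b αa βb e →
          inc a b (α⊆ a αa) (β⊆ b βb) (trans (same a b αa βb) e))
        where
        same : ∀ a b → α′ a ≡ true → β′ b ≡ true → zeros T a b ≡ zeros r a b
        same a b αa βb rewrite inQ a b αa βb = refl
      left : ∀ α′ β′ → α′ ⊆ α → β′ ⊆ β → α′ ⊠ β′ ⊆ (λ a b → not (Qfg a b)) →
             pairs α′ β′ (zeros T) ≤ K * perimeter α′ β′
      left α′ β′ α⊆ β⊆ inQ = descend l (m≤m⊔n (cost l) (cost r)) α′ β′ α⊆ β⊆ same
        (zeros-bound l α′ β′ λ a b αa βb e →
          inc a b (α⊆ a αa) (β⊆ b βb) (trans (same a b αa βb) e))
        where
        same : ∀ a b → α′ a ≡ true → β′ b ≡ true → zeros T a b ≡ zeros l a b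
        same a b αa βb with Q (f a) (g b) | inQ a b αa βb
        ... | false | _ = refl

-- Covering pairs at distance at most k

does⁻ : ∀ {P : Set} (P? : Dec P) → does P? ≡ true → P
does⁻ (yes p) _ = p

_≟ʷ_ : ∀ {m} (x y : Word m) → Dec (x ≡ y)
_≟ʷ_ = Vec.≡-dec Bool._≟_

differ : Bool → Bool → ℕ
differ a b = bit (not (does (a Bool.≟ b)))

hamming-∷ : ∀ {m} a b (x y : Word m) → hamming (a ∷ x) (b ∷ y) ≡ differ a b + hamming x y
hamming-∷ false false x y = refl
hamming-∷ false true  x y = refl
hamming-∷ true  false x y = refl
hamming-∷ true  true  x y = refl

hamming-refl : ∀ {m} (x : Word m) → hamming x x ≡ 0
hamming-refl []          = refl
hamming-refl (false ∷ x) = hamming-refl x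
hamming-refl (true  ∷ x) = hamming-refl x

hamming≡0⇒≡ : ∀ {m} (x y : Word m) → hamming x y ≡ 0 → x ≡ y
hamming≡0⇒≡ []          []          e = refl
hamming≡0⇒≡ (false ∷ x) (false ∷ y) e = cong (false ∷_) (hamming≡0⇒≡ x y e)
hamming≡0⇒≡ (true  ∷ x) (true  ∷ y) e = cong (true ∷_) (hamming≡0⇒≡ x y e)

hamming-sym : ∀ {m} (x y : Word m) → hamming x y ≡ hamming y x
hamming-sym []          []          = refl
hamming-sym (false ∷ x) (false ∷ y) = hamming-sym x y
hamming-sym (false ∷ x) (true  ∷ y) = cong suc (hamming-sym x y)
hamming-sym (true  ∷ x) (false ∷ y) = cong suc (hamming-sym x y)
hamming-sym (true  ∷ x) (true  ∷ y) = hamming-sym x y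

hamming≤length : ∀ {m} (x y : Word m) → hamming x y ≤ m
hamming≤length []      []      = z≤n
hamming≤length (a ∷ x) (b ∷ y) rewrite hamming-∷ a b x y = +-mono-≤ (bit≤1 _) (hamming≤length x y)

hamming-replicate : ∀ m → hamming (replicate m false) (replicate m true) ≡ m
hamming-replicate zero    = refl
hamming-replicate (suc m) = cong suc (hamming-replicate m)

differ-triangle : ∀ a b c → differ a b ≤ differ a c + differ b c
differ-triangle false false c     = z≤n
differ-triangle true  true  c     = z≤n
differ-triangle false true  false = s≤s z≤n
differ-triangle false true  true  = s≤s z≤n
differ-triangle true  false false = s≤s z≤n
differ-triangle true  false true  = s≤s z≤n

hamming-triangle : ∀ {m} (x y z : Word m) → hamming x y ≤ hamming x z + hamming y z
hamming-triangle []      []      []      = z≤n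
hamming-triangle (a ∷ x) (b ∷ y) (c ∷ z)
  rewrite hamming-∷ a b x y | hamming-∷ a c x z | hamming-∷ b c y z = begin
    differ a b + hamming x y
      ≤⟨ +-mono-≤ (differ-triangle a b c) (hamming-triangle x y z) ⟩
    differ a c + differ b c + (hamming x z + hamming y z)
      ≡⟨ interchange (differ a c) (differ b c) (hamming x z) (hamming y z) ⟩
    differ a c + hamming x z + (differ b c + hamming y z) ∎
  where
  open ≤-Reasoning
  interchange : ∀ a b c d → a + b + (c + d) ≡ a + c + (b + d)
  interchange = solve-∀

words : ∀ m → List (Word m)
words zero    = [] ∷ []
words (suc m) = cartesianProductWith _∷_ (false ∷ true ∷ []) (words m)

words-complete : ∀ {m} (x : Word m) → x ∈ words m
words-complete []      = here refl
words-complete (b ∷ x) = ∈-cartesianProductWith⁺ _∷_ (bits-complete b) (words-complete x)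
  where
  bits-complete : ∀ b → b ∈ false ∷ true ∷ []
  bits-complete false = here refl
  bits-complete true  = there (here refl)

words-unique : ∀ m → Unique (words m)
words-unique zero    = [] ∷ []
words-unique (suc m) = Unique.cartesianProductWith⁺ _∷_ Vec.∷-injective
  (((λ ()) ∷ []) ∷ ([] ∷ [])) (words-unique m)

-- The half starting with `b` comes first, so that the head of a given word can lead whatever its
-- value.
∑-words : ∀ {m} b (f : Word (suc m) → ℕ) →
  ∑ (words (suc m)) f ≡ ∑ (words m) (f ∘ (b ∷_)) + ∑ (words m) (f ∘ (not b ∷_))
∑-words {m} false f = trans (∑-cartesianProductWith _∷_ (false ∷ true ∷ []) (words m) f)
  (cong (∑ (words m) (f ∘ (false ∷_)) +_) (+-identityʳ _))
∑-words {m} true f = trans (∑-words false f) (+-comm (∑ (words m) (f ∘ (false ∷_))) _)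

side : ∀ {m} → Bool → List (Word (suc m)) → List (Word m)
side b []            = []
side b ((a ∷ x) ∷ S) = if does (a Bool.≟ b) then x ∷ side b S else side b S

majority : ∀ {m} → List (Word (suc m)) → Bool
majority S = does (length (side false S) ≤? length (side true S))

descend : ∀ {m} → Bool → List (Word (suc m)) → List (Word m)
descend b S = if does (b Bool.≟ majority S) then map tail S else side b S

-- Reading z bit by bit, keep a list of tails: all of them while z follows the
-- majority, and only those of the words agreeing with z when it does not (so
-- the list is halved).  x may be moved to z by flips towards the majority only.
compatible : ∀ {m} → List (Word m) → Word m → Word m → Bool
compatible S []      []      = true
compatible S (a ∷ x) (b ∷ z) =
  (does (a Bool.≟ b) ∨ does (b Bool.≟ majority S)) ∧ compatible (descend b S) x z

centre : ∀ {m} → List (Word m) → Word m → Word m → Word m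
centre S []      []      = []
centre S (a ∷ x) (b ∷ y) = c ∷ centre (descend c S) x y
  where c = if does (a Bool.≟ b) then a else majority S

-- Both words are read along the same centre, hence with the same lists. Where they disagree the
-- centre has the majority bit, so whichever word moves there makes a permitted flip.
centre-compatible : ∀ {m} (S : List (Word m)) x y →
  compatible S x (centre S x y) ≡ true × compatible S y (centre S x y) ≡ true
centre-compatible S []      []      = refl , refl
centre-compatible S (a ∷ x) (b ∷ y) =
  let p , q = head a b (majority S) ; u , v = centre-compatible (descend c S) x y
  in ∧⁺ p u , ∧⁺ q v
  where
  c = if does (a Bool.≟ b) then a else majority S
  head : ∀ a b h → let c = if does (a Bool.≟ b) then a else h in
    does (a Bool.≟ c) ∨ does (c Bool.≟ h) ≡ true × does (b Bool.≟ c) ∨ does (c Bool.≟ h) ≡ true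
  head false false h     = refl , refl
  head true  true  h     = refl , refl
  head false true  false = refl , refl
  head false true  true  = refl , refl
  head true  false false = refl , refl
  head true  false true  = refl , refl

-- Each bit of the centre is the bit of `x` or of `y`, so the centre lies on a shortest path between
-- them.
hamming-centre : ∀ {m} (S : List (Word m)) x y →
  hamming x (centre S x y) + hamming y (centre S x y) ≡ hamming x y
hamming-centre S []      []      = refl
hamming-centre S (a ∷ x) (b ∷ y) = trans
  (cong₂ _+_ (hamming-∷ a c x z) (hamming-∷ b c y z)) (trans
  (head a b (majority S) (hamming x z) (hamming y z)) (trans
  (cong (differ a b +_) (hamming-centre (descend c S) x y))
  (sym (hamming-∷ a b x y))))
  where
  c = if does (a Bool.≟ b) then a else majority S
  z = centre (descend c S) x y
  head : ∀ a b h u v → let c = if does (a Bool.≟ b) then a else h in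
    differ a c + u + (differ b c + v) ≡ differ a b + (u + v)
  head false false h     u v = refl
  head true  true  h     u v = refl
  head false true  false u v = +-suc u v
  head false true  true  u v = refl
  head true  false false u v = refl
  head true  false true  u v = +-suc u v

length-side : ∀ {m} a (S : List (Word (suc m))) →
  length (side a S) + length (side (not a) S) ≡ length S
length-side a     []                = refl
length-side false ((false ∷ x) ∷ S) = cong suc (length-side false S)
length-side false ((true  ∷ x) ∷ S) = trans (+-suc _ _) (cong suc (length-side false S))
length-side true  ((true  ∷ x) ∷ S) = cong suc (length-side true S)
length-side true  ((false ∷ x) ∷ S) = trans (+-suc _ _) (cong suc (length-side true S))

∈-side : ∀ {m a} {x : Word m} {S} → (a ∷ x) ∈ S → x ∈ side a S
∈-side {a = false} {S = (false ∷ x) ∷ S} (here refl) = here refl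
∈-side {a = true}  {S = (true  ∷ x) ∷ S} (here refl) = here refl
∈-side {a = false} {S = (false ∷ x) ∷ S} (there x∈)  = there (∈-side x∈)
∈-side {a = true}  {S = (true  ∷ x) ∷ S} (there x∈)  = there (∈-side x∈)
∈-side {a = false} {S = (true  ∷ x) ∷ S} (there x∈)  = ∈-side x∈
∈-side {a = true}  {S = (false ∷ x) ∷ S} (there x∈)  = ∈-side x∈

minority-≤ : ∀ {m} a (S : List (Word (suc m))) → majority S ≡ not a →
             length (side a S) ≤ length (side (not a) S)
minority-≤ false S e = does⁻ (length (side false S) ≤? length (side true S)) e
minority-≤ true  S e = <⇒≤ (≰⇒> λ ≤ → contradiction (trans (sym e) (dec-true (length (side false S) ≤? length (side true S)) ≤)) λ ())

minority-halves : ∀ {m} a (S : List (Word (suc m))) {Λ} → majority S ≡ not a →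
                  length S < 2 ^ suc Λ → length (side a S) < 2 ^ Λ
minority-halves a S {Λ} e S< = *-cancelˡ-< 2 _ _ (begin-strict
  2 * length (side a S)                           ≡⟨ cong (length (side a S) +_) (+-identityʳ _) ⟩
  length (side a S) + length (side a S)           ≤⟨ +-monoʳ-≤ (length (side a S)) (minority-≤ a S e) ⟩
  length (side a S) + length (side (not a) S)     ≡⟨ length-side a S ⟩
  length S                                        <⟨ S< ⟩
  2 ^ suc Λ                                       ∎)
  where open ≤-Reasoning

reaches : ∀ {m} → List (Word m) → ℕ → Word m → Word m → Bool
reaches S i x z = compatible S x z ∧ does (hamming x z ≤? i)

module _ {m} (S : List (Word (suc m))) where

  reaches-majority : ∀ a i x z → majority S ≡ a →
    reaches S i (a ∷ x) (a ∷ z) ≡ reaches (map tail S) i x z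
  reaches-majority false i x z e rewrite e = refl
  reaches-majority true  i x z e rewrite e = refl

  ¬reaches-minority : ∀ a i x z → majority S ≡ a → reaches S i (a ∷ x) (not a ∷ z) ≡ false
  ¬reaches-minority false i x z e rewrite e = refl
  ¬reaches-minority true  i x z e rewrite e = refl

  reaches-minority : ∀ a i x z → majority S ≡ not a →
    reaches S i (a ∷ x) (a ∷ z) ≡ reaches (side a S) i x z
  reaches-minority false i x z e rewrite e = refl
  reaches-minority true  i x z e rewrite e = refl

  reaches-flip : ∀ a i x z → majority S ≡ not a →
    reaches S (suc i) (a ∷ x) (not a ∷ z) ≡ true → reaches (map tail S) i x z ≡ true
  reaches-flip a i x z e r = let p , q = unfold a e r in
    ∧⁺ p (dec-true (hamming x z ≤? i) (≤-pred (does⁻ (suc (hamming x z) ≤? suc i) q)))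
    where
    unfold : ∀ a → majority S ≡ not a → reaches S (suc i) (a ∷ x) (not a ∷ z) ≡ true →
      compatible (map tail S) x z ≡ true × does (suc (hamming x z) ≤? suc i) ≡ true
    unfold false e r rewrite e = ∧⁻ {compatible (map tail S) x z} r
    unfold true  e r rewrite e = ∧⁻ {compatible (map tail S) x z} r

  ¬reaches-flip : ∀ a x z → reaches S 0 (a ∷ x) (not a ∷ z) ≡ false
  ¬reaches-flip false x z = ∧-zeroʳ _
  ¬reaches-flip true  x z = ∧-zeroʳ _

-- A majority head cannot be flipped, and keeping it leaves `Λ` and `i` alone. A minority head is
-- either kept, which halves the list and lowers `Λ`, or flipped, which lowers `i`. So choices arise
-- only where one of the two parameters drops, and `m` does not enter the bound.
reaches-count : ∀ {m} (S : List (Word m)) i x Λ → x ∈ S → length S < 2 ^ Λ →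
                size (words m) (reaches S i x) ≤ suc Λ ^ i
reaches-count {zero} S i [] Λ x∈ S< = ≤-trans (+-monoˡ-≤ 0 (bit≤1 (does (0 ≤? i)))) (m^n>0 (suc Λ) i)
-- The list still contains the word itself, so it cannot be halved below length 1.
reaches-count {suc m} S i (a ∷ x) zero x∈ (s≤s S≤0) = contradiction (nonempty x∈) (<⇒≱ (s≤s S≤0))
  where
  nonempty : ∀ {A : Set} {y : A} {ys} → y ∈ ys → 1 ≤ length ys
  nonempty (here _)  = s≤s z≤n
  nonempty (there _) = s≤s z≤n
reaches-count {suc m} S i (a ∷ x) (suc Λ) x∈ S< with majority S Bool.≟ a
... | yes h≡a = begin
  size (words (suc m)) (reaches S i (a ∷ x))
    ≡⟨ ∑-words {m} a (bit ∘ reaches S i (a ∷ x)) ⟩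
  size (words m) (reaches S i (a ∷ x) ∘ (a ∷_)) + size (words m) (reaches S i (a ∷ x) ∘ (not a ∷_))
    ≡⟨ cong₂ _+_ (∑-cong (words m) λ z → cong bit (reaches-majority S a i x z h≡a))
                 (size-zero (words m) λ {z} _ → ¬reaches-minority S a i x z h≡a) ⟩
  size (words m) (reaches (map tail S) i x) + 0
    ≡⟨ +-identityʳ _ ⟩
  size (words m) (reaches (map tail S) i x)
    ≤⟨ reaches-count (map tail S) i x (suc Λ) (∈-map⁺ tail x∈) (≤-<-trans (≤-reflexive (length-map tail S)) S<) ⟩
  suc (suc Λ) ^ i ∎
  where open ≤-Reasoning
... | no h≢a = begin
  size (words (suc m)) (reaches S i (a ∷ x))
    ≡⟨ ∑-words {m} a (bit ∘ reaches S i (a ∷ x)) ⟩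
  size (words m) (reaches S i (a ∷ x) ∘ (a ∷_)) + size (words m) (reaches S i (a ∷ x) ∘ (not a ∷_))
    ≡⟨ cong (_+ size (words m) (reaches S i (a ∷ x) ∘ (not a ∷_)))
         (∑-cong (words m) λ z → cong bit (reaches-minority S a i x z h≡¬a)) ⟩
  size (words m) (reaches (side a S) i x) + size (words m) (reaches S i (a ∷ x) ∘ (not a ∷_))
    ≤⟨ +-monoˡ-≤ _ (reaches-count (side a S) i x Λ (∈-side x∈) (minority-halves a S {Λ} h≡¬a S<)) ⟩
  suc Λ ^ i + size (words m) (reaches S i (a ∷ x) ∘ (not a ∷_))
    ≤⟨ flips i ⟩
  suc (suc Λ) ^ i ∎
  where
  open ≤-Reasoning
  h≡¬a : majority S ≡ not a
  h≡¬a = ¬-not h≢a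
  flips : ∀ i → suc Λ ^ i + size (words m) (reaches S i (a ∷ x) ∘ (not a ∷_)) ≤ suc (suc Λ) ^ i
  flips zero    = ≤-reflexive (cong suc (size-zero (words m) λ {z} _ → ¬reaches-flip S a x z))
  -- A flip spends one unit of `suc i` and keeps the list at full length. Raised to the common base
  -- `suc (suc Λ)`, the two terms have coefficients `suc Λ` and 1, which make up one more factor of
  -- the base.
  flips (suc i) = begin
    suc Λ * suc Λ ^ i + size (words m) (reaches S (suc i) (a ∷ x) ∘ (not a ∷_))
      ≤⟨ +-mono-≤ (*-monoʳ-≤ (suc Λ) (^-monoˡ-≤ i (n≤1+n (suc Λ))))
                  (∑-mono (words m) λ {z} _ → bit-mono (reaches-flip S a i x z h≡¬a)) ⟩
    suc Λ * suc (suc Λ) ^ i + size (words m) (reaches (map tail S) i x)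
      ≤⟨ +-monoʳ-≤ (suc Λ * suc (suc Λ) ^ i)
           (reaches-count (map tail S) i x (suc Λ) (∈-map⁺ tail x∈) (≤-<-trans (≤-reflexive (length-map tail S)) S<)) ⟩
    suc Λ * suc (suc Λ) ^ i + suc (suc Λ) ^ i
      ≡⟨ +-comm (suc Λ * suc (suc Λ) ^ i) _ ⟩
    suc (suc Λ) ^ suc i ∎

upTo-≤ : ∀ {k i} → i ∈ upTo (suc k) → i ≤ k
upTo-≤ i∈ = ≤-pred (∈-upTo⁻ i∈)

module _ {A B : Set} {m} (rows : List A) (cols : List B) (f : A → Word m) (g : B → Word m)
         (k Λ : ℕ) (small : length rows + length cols < 2 ^ Λ)
  where
  open Rectangle rows cols

  near : A → B → Bool
  near r c = does (hamming (f r) (g c) ≤? k)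

  private
    -- Majorities are taken over the words of all rows and columns together, so the counts depend on
    -- how many indices there are and not on `m`.
    S : List (Word m)
    S = map f rows ++ map g cols

    S< : length S < 2 ^ Λ
    S< = ≤-<-trans (≤-reflexive (trans (length-++ (map f rows)) (cong₂ _+_ (length-map f rows) (length-map g cols)))) small

    M = suc k * suc Λ ^ k

    instance
      M≢0 : NonZero M
      M≢0 = m*n≢0 (suc k) (suc Λ ^ k) {{_}} {{m^n≢0 (suc Λ) k}}

    -- A key is a centre with a budget `i`: the row word comes within `i` of it and the column word
    -- within `k - i`. Without the budget, sharing a centre would only bound the distance by `2k`.
    centres : List (Word m × ℕ)
    centres = cartesianProduct (words m) (upTo (suc k))

    κ : A → Word m × ℕ → Bool
    κ r (z , i) = compatible S (f r) z ∧ does (hamming (f r) z ≤? i)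

    κ′ : B → Word m × ℕ → Bool
    κ′ c (z , i) = compatible S (g c) z ∧ does (hamming (g c) z + i ≤? k)

    few : ∀ x (χ : Word m × ℕ → Bool) → x ∈ S →
          (∀ z i → i ≤ k → χ (z , i) ≡ true → reaches S k x z ≡ true) → size centres χ ≤ M
    few x χ x∈ h = begin
      size centres χ
        ≡⟨ ∑-cartesianProductWith _,_ (words m) (upTo (suc k)) _ ⟩
      ∑[ z ∈ words m ] ∑[ i ∈ upTo (suc k) ] bit (χ (z , i))
        ≤⟨ ∑-mono (words m) (λ {z} _ → ∑-mono (upTo (suc k)) λ {i} i∈ → bit-mono (h z i (upTo-≤ i∈))) ⟩
      ∑[ z ∈ words m ] ∑[ i ∈ upTo (suc k) ] bit (reaches S k x z)
        ≡⟨ ∑-swap (words m) (upTo (suc k)) _ ⟩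
      ∑[ i ∈ upTo (suc k) ] size (words m) (reaches S k x)
        ≡⟨ ∑-const (upTo (suc k)) _ ⟩
      length (upTo (suc k)) * size (words m) (reaches S k x)
        ≤⟨ *-mono-≤ (≤-reflexive (length-upTo (suc k))) (reaches-count S k x Λ x∈ S<) ⟩
      M ∎
      where open ≤-Reasoning

  -- Two close words are guaranteed a single common key, their centre with the distance of the row
  -- word to it. The factor lost is therefore the whole number `M` of keys allowed per word.
  near-coverable : Coverable near (suc k * suc Λ ^ k)
  near-coverable = shared-keys⇒coverable centres κ κ′ near {M} {M} sound
    (λ {r} r∈ → few (f r) (κ r) (∈-++⁺ˡ (∈-map⁺ f r∈)) λ z i i≤k e →
       let p , q = ∧⁻ {compatible S (f r) z} e
       in ∧⁺ p (dec-true (hamming (f r) z ≤? k) (≤-trans (does⁻ (hamming (f r) z ≤? i) q) i≤k)))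
    (λ {c} c∈ → few (g c) (κ′ c) (∈-++⁺ʳ (map f rows) (∈-map⁺ g c∈)) λ z i i≤k e →
       let p , q = ∧⁻ {compatible S (g c) z} e
       in ∧⁺ p (dec-true (hamming (g c) z ≤? k)
            (≤-trans (m≤m+n _ i) (does⁻ (hamming (g c) z + i ≤? k) q))))
    many
    where
    sound : ∀ {r c zi} → κ r zi ≡ true → κ′ c zi ≡ true → near r c ≡ true
    sound {r} {c} {z , i} κr κc = dec-true (hamming (f r) (g c) ≤? k) (begin
      hamming (f r) (g c)                     ≤⟨ hamming-triangle (f r) (g c) z ⟩
      hamming (f r) z + hamming (g c) z       ≤⟨ +-monoˡ-≤ _ (does⁻ (hamming (f r) z ≤? i) (proj₂ (∧⁻ {compatible S (f r) z} κr))) ⟩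
      i + hamming (g c) z                     ≡⟨ +-comm i _ ⟩
      hamming (g c) z + i                     ≤⟨ does⁻ (hamming (g c) z + i ≤? k) (proj₂ (∧⁻ {compatible S (g c) z} κc)) ⟩
      k                                       ∎)
      where open ≤-Reasoning
    many : ∀ {r c} → r ∈ rows → c ∈ cols → near r c ≡ true →
           M ≤ M * size centres (λ zi → κ r zi ∧ κ′ c zi)
    many {r} {c} _ _ close = ≤-trans (≤-reflexive (sym (*-identityʳ M))) (*-monoʳ-≤ M (begin
      1                                     ≡⟨ cong bit shared ⟨
      bit (κ r (z , i) ∧ κ′ c (z , i))      ≤⟨ ∈⇒≤∑ (λ zi → bit (κ r zi ∧ κ′ c zi))
                                                 (∈-cartesianProduct⁺ (words-complete z) (∈-upTo⁺ (s≤s i≤k))) ⟩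
      size centres (λ zi → κ r zi ∧ κ′ c zi) ∎))
      where
      open ≤-Reasoning
      z = centre S (f r) (g c)
      i = hamming (f r) z
      within : hamming (g c) z + i ≤ k
      within = ≤-trans (≤-reflexive (trans (+-comm _ i) (hamming-centre S (f r) (g c)))) (does⁻ (hamming (f r) (g c) ≤? k) close)
      i≤k : i ≤ k
      i≤k = ≤-trans (m≤n+m i _) within
      shared : κ r (z , i) ∧ κ′ c (z , i) ≡ true
      shared = let p , q = centre-compatible S (f r) (g c) in
        ∧⁺ (∧⁺ p (dec-true (i ≤? i) ≤-refl)) (∧⁺ q (dec-true (hamming (g c) z + i ≤? k) within))

-- Covering pairs at distance more than k

flip : ∀ {K} → Fin K → Word K → Word K
flip i h = updateAt h i not

hamming-flip₂ : ∀ {K} (i : Fin K) h h′ → hamming (flip i h) (flip i h′) ≡ hamming h h′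
hamming-flip₂ zero    (false ∷ h) (false ∷ h′) = refl
hamming-flip₂ zero    (false ∷ h) (true  ∷ h′) = refl
hamming-flip₂ zero    (true  ∷ h) (false ∷ h′) = refl
hamming-flip₂ zero    (true  ∷ h) (true  ∷ h′) = refl
hamming-flip₂ (suc i) (a ∷ h)     (b ∷ h′)
  rewrite hamming-∷ a b (flip i h) (flip i h′) | hamming-∷ a b h h′ =
  cong (differ a b +_) (hamming-flip₂ i h h′)

hamming-flip : ∀ {K} (i : Fin K) h → hamming h (flip i h) ≡ 1
hamming-flip zero    (false ∷ h) = cong suc (hamming-refl h)
hamming-flip zero    (true  ∷ h) = cong suc (hamming-refl h)
hamming-flip (suc i) (false ∷ h) = hamming-flip i h
hamming-flip (suc i) (true  ∷ h) = hamming-flip i h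

flip-closer : ∀ {K} (h h′ : Word K) → 0 < hamming h h′ →
              ∃[ i ] suc (hamming (flip i h) h′) ≡ hamming h h′
flip-closer []          []           ()
flip-closer (false ∷ h) (true  ∷ h′) _  = zero , refl
flip-closer (true  ∷ h) (false ∷ h′) _  = zero , refl
flip-closer (false ∷ h) (false ∷ h′) 0< = let i , e = flip-closer h h′ 0< in suc i , e
flip-closer (true  ∷ h) (true  ∷ h′) 0< = let i , e = flip-closer h h′ 0< in suc i , e

-- Bin 0 is discarded: without it the parities would have a fixed total.
toggle : ∀ {K} → Bool → Fin (suc K) → Word K → Word K
toggle false j       h = h
toggle true  zero    h = h
toggle true  (suc i) h = flip i h

-- Equal bits act alike on both accumulators; differing bits flip at most one position in only one
-- of them.
toggle-differ : ∀ {K} a b j (h h′ : Word K) →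
  hamming h h′ ≤ differ a b + hamming (toggle a j h) (toggle b j h′)
toggle-differ false false j       h h′ = ≤-refl
toggle-differ false true  zero    h h′ = n≤1+n _
toggle-differ true  false zero    h h′ = n≤1+n _
toggle-differ true  true  zero    h h′ = ≤-refl
toggle-differ true  true  (suc i) h h′ = ≤-reflexive (sym (hamming-flip₂ i h h′))
toggle-differ false true  (suc i) h h′ = begin
  hamming h h′                                    ≤⟨ hamming-triangle h h′ (flip i h′) ⟩
  hamming h (flip i h′) + hamming h′ (flip i h′)  ≡⟨ cong (hamming h (flip i h′) +_) (hamming-flip i h′) ⟩
  hamming h (flip i h′) + 1                       ≡⟨ +-comm _ 1 ⟩
  suc (hamming h (flip i h′))                     ∎
  where open ≤-Reasoning
toggle-differ true  false (suc i) h h′ = begin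
  hamming h h′                                    ≤⟨ hamming-triangle h h′ (flip i h) ⟩
  hamming h (flip i h) + hamming h′ (flip i h)    ≡⟨ cong₂ _+_ (hamming-flip i h) (hamming-sym h′ (flip i h)) ⟩
  suc (hamming (flip i h) h′)                     ∎
  where open ≤-Reasoning

-- Exactly one of the two words toggles its accumulator, and it can do so at a position where the
-- accumulators disagree. If they are within `w` already, the discarded bin 0 changes nothing.
toggle-closer : ∀ {K} a (h h′ : Word K) {w} → hamming h h′ ≤ suc w →
  ∃[ j ] hamming (toggle a j h) (toggle (not a) j h′) ≤ w
toggle-closer a h h′ {w} h≤ with hamming h h′ ≤? w
... | yes ≤w = zero , dummy a
  where
  dummy : ∀ a → hamming (toggle a zero h) (toggle (not a) zero h′) ≤ w
  dummy false = ≤w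
  dummy true  = ≤w
toggle-closer true h h′ h≤ | no ≰w =
  let i , e = flip-closer h h′ (≤-<-trans z≤n (≰⇒> ≰w))
  in suc i , ≤-pred (≤-trans (≤-reflexive e) h≤)
toggle-closer false h h′ h≤ | no ≰w =
  let i , e = flip-closer h′ h (≤-trans (≤-<-trans z≤n (≰⇒> ≰w)) (≤-reflexive (hamming-sym h h′)))
  in suc i , ≤-pred (≤-trans (≤-reflexive
       (trans (cong suc (hamming-sym h (flip i h′))) (trans e (hamming-sym h′ h)))) h≤)

-- A seed throws the coordinates into bins; the hash records the parity of each bin.
hash : ∀ {K m} → Vec (Fin (suc K)) m → Word m → Word K → Word K
hash []      []      h = h
hash (j ∷ s) (a ∷ x) h = hash s x (toggle a j h)

-- Soundness of the hash: accumulators that start far apart and end equal must have been brought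
-- together by as many differing coordinates.
hash-differ : ∀ {K m} (s : Vec (Fin (suc K)) m) x y h h′ →
  hamming h h′ ≤ hamming x y + hamming (hash s x h) (hash s y h′)
hash-differ []      []      []      h h′ = ≤-refl
hash-differ (j ∷ s) (a ∷ x) (b ∷ y) h h′ rewrite hamming-∷ a b x y = begin
  hamming h h′
    ≤⟨ toggle-differ a b j h h′ ⟩
  differ a b + hamming (toggle a j h) (toggle b j h′)
    ≤⟨ +-monoʳ-≤ (differ a b) (hash-differ s x y (toggle a j h) (toggle b j h′)) ⟩
  differ a b + (hamming x y + hamming (hash s x (toggle a j h)) (hash s y (toggle b j h′)))
    ≡⟨ +-assoc (differ a b) _ _ ⟨
  differ a b + hamming x y + hamming (hash s x (toggle a j h)) (hash s y (toggle b j h′)) ∎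
  where open ≤-Reasoning

seeds : ∀ q m → List (Vec (Fin q) m)
seeds q zero    = [] ∷ []
seeds q (suc m) = cartesianProductWith _∷_ (allFin q) (seeds q m)

length-allFin : ∀ q → length (allFin q) ≡ q
length-allFin q = length-tabulate {n = q} (λ i → i)

∑-seeds-const : ∀ q m c → ∑[ _ ∈ seeds q m ] c ≡ q ^ m * c
∑-seeds-const q zero    c = refl
∑-seeds-const q (suc m) c = begin
  ∑[ _ ∈ seeds q (suc m) ] c                 ≡⟨ ∑-cartesianProductWith _∷_ (allFin q) (seeds q m) _ ⟩
  ∑[ _ ∈ allFin q ] ∑[ _ ∈ seeds q m ] c     ≡⟨ ∑-cong (allFin q) (λ _ → ∑-seeds-const q m c) ⟩
  ∑[ _ ∈ allFin q ] (q ^ m * c)              ≡⟨ ∑-const (allFin q) _ ⟩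
  length (allFin q) * (q ^ m * c)            ≡⟨ cong (_* (q ^ m * c)) (length-allFin q) ⟩
  q * (q ^ m * c)                            ≡⟨ *-assoc q _ _ ⟨
  q ^ suc m * c                              ∎
  where open ≡-Reasoning

module _ {K : ℕ} where
  private
    q : ℕ
    q = suc K

  collide : ∀ {m} → Word m → Word m → Word K → Word K → Vec (Fin q) m → Bool
  collide x y h h′ s = does (hash s x h ≟ʷ hash s y h′)

  collisions : ∀ {m} → Word m → Word m → Word K → Word K → ℕ
  collisions {m} x y h h′ = size (seeds q m) (collide x y h h′)

  collisions-∷ : ∀ {m} a b (x y : Word m) h h′ → collisions (a ∷ x) (b ∷ y) h h′ ≡
    ∑[ j ∈ allFin q ] collisions x y (toggle a j h) (toggle b j h′)
  collisions-∷ {m} a b x y h h′ = ∑-cartesianProductWith _∷_ (allFin q) (seeds q m) _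

  -- If every bin for the first coordinate is good, the longer seed costs no further factor `q`.
  collisions-average : ∀ {m} a b (x y : Word m) h h′ w →
    (∀ j → q ^ m ≤ q ^ w * collisions x y (toggle a j h) (toggle b j h′)) →
    q ^ suc m ≤ q ^ w * collisions (a ∷ x) (b ∷ y) h h′
  collisions-average {m} a b x y h h′ w each = begin
    q * q ^ m                                        ≡⟨ cong (_* q ^ m) (length-allFin q) ⟨
    length (allFin q) * q ^ m                        ≡⟨ ∑-const (allFin q) _ ⟨
    ∑[ _ ∈ allFin q ] (q ^ m)                        ≤⟨ ∑-mono (allFin q) (λ {j} _ → each j) ⟩
    ∑[ j ∈ allFin q ] (q ^ w * collisions x y (toggle a j h) (toggle b j h′))
                                                     ≡⟨ ∑-*ˡ (q ^ w) (allFin q) _ ⟩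
    q ^ w * (∑[ j ∈ allFin q ] collisions x y (toggle a j h) (toggle b j h′))
                                                     ≡⟨ cong (q ^ w *_) (collisions-∷ a b x y h h′) ⟨
    q ^ w * collisions (a ∷ x) (b ∷ y) h h′          ∎
    where open ≤-Reasoning

  -- While more than w coordinates still differ every bin is allowed, because
  -- no two accumulators are further than K ≤ w apart; afterwards each differing
  -- coordinate has a bin bringing the accumulators closer.
  collisions-bound : ∀ {m} (x y : Word m) h h′ w → hamming h h′ ≤ w → w ≤ hamming x y →
    w ≡ hamming x y ⊎ K ≤ w → q ^ m ≤ q ^ w * collisions x y h h′
  closing : ∀ {m} a (x y : Word m) h h′ w → hamming h h′ ≤ suc w → w ≡ hamming x y →
    q ^ suc m ≤ q ^ suc w * collisions (a ∷ x) (not a ∷ y) h h′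

  collisions-bound [] [] h h′ zero h≤ _ _
    rewrite dec-true (h ≟ʷ h′) (hamming≡0⇒≡ h h′ (n≤0⇒n≡0 h≤)) = ≤-refl
  collisions-bound {suc m} (a ∷ x) (b ∷ y) h h′ w h≤ w≤ c = heads a b w≤ c
    where
    -- Equal bits toggle the same bin on both sides, so every bin preserves the distance of the
    -- accumulators.
    same : ∀ a → w ≤ hamming x y → w ≡ hamming x y ⊎ K ≤ w →
           q ^ suc m ≤ q ^ w * collisions (a ∷ x) (a ∷ y) h h′
    same a w≤ c = collisions-average a a x y h h′ w λ j →
      collisions-bound x y _ _ w (≤-trans (≤-reflexive (preserved a j)) h≤) w≤ c
      where
      preserved : ∀ a j → hamming (toggle a j h) (toggle a j h′) ≡ hamming h h′
      preserved false j       = refl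
      preserved true  zero    = refl
      preserved true  (suc i) = hamming-flip₂ i h h′
    opposite : ∀ a → w ≤ suc (hamming x y) → w ≡ suc (hamming x y) ⊎ K ≤ w →
               q ^ suc m ≤ q ^ w * collisions (a ∷ x) (not a ∷ y) h h′
    opposite a w≤ (inj₁ refl) = closing a x y h h′ (hamming x y) h≤ refl
    opposite a w≤ (inj₂ K≤w) with m≤n⇒m<n∨m≡n w≤
    ... | inj₁ w<   = collisions-average a (not a) x y h h′ w λ j →
      collisions-bound x y _ _ w
        (≤-trans (hamming≤length (toggle a j h) (toggle (not a) j h′)) K≤w) (≤-pred w<) (inj₂ K≤w)
    ... | inj₂ refl = closing a x y h h′ (hamming x y) h≤ refl
    heads : ∀ a b → w ≤ hamming (a ∷ x) (b ∷ y) → w ≡ hamming (a ∷ x) (b ∷ y) ⊎ K ≤ w →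
            q ^ suc m ≤ q ^ w * collisions (a ∷ x) (b ∷ y) h h′
    heads false false = same false
    heads true  true  = same true
    heads false true  = opposite false
    heads true  false = opposite true

  -- Only one bin out of `q` is kept; this loss is paid by one factor of `q ^ suc w`.
  closing {m} a x y h h′ w h≤ refl = let j , j≤ = toggle-closer a h h′ h≤ in begin
    q * q ^ m
      ≤⟨ *-monoʳ-≤ q (collisions-bound x y _ _ w j≤ ≤-refl (inj₁ refl)) ⟩
    q * (q ^ w * collisions x y (toggle a j h) (toggle (not a) j h′))
      ≡⟨ *-assoc q (q ^ w) _ ⟨
    q ^ suc w * collisions x y (toggle a j h) (toggle (not a) j h′)
      ≤⟨ *-monoʳ-≤ (q ^ suc w) (∈⇒≤∑ (λ j → collisions x y (toggle a j h) (toggle (not a) j h′)) (∈-allFin j)) ⟩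
    q ^ suc w * (∑[ j ∈ allFin q ] collisions x y (toggle a j h) (toggle (not a) j h′))
      ≡⟨ cong (q ^ suc w *_) (collisions-∷ a (not a) x y h h′) ⟨
    q ^ suc w * collisions (a ∷ x) (not a ∷ y) h h′ ∎
    where open ≤-Reasoning

module _ {A B : Set} {m} (rows : List A) (cols : List B) (f : A → Word m) (g : B → Word m) (k : ℕ)
  where
  open Rectangle rows cols

  far : A → B → Bool
  far r c = not (does (hamming (f r) (g c) ≤? k))

  private
    K q : ℕ
    K = suc k
    q = suc K

    instance
      M≢0 : NonZero (q ^ m)
      M≢0 = m^n≢0 q m

    -- Starting rows at all zeros and columns at all ones turns opposite parities in every counted
    -- bin into equality of hashes.
    falses trues : Word K
    falses = replicate K false
    trues  = replicate K true

    hashes : List (Vec (Fin q) m × Word K)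
    hashes = cartesianProduct (seeds q m) (words K)

    κ : A → Vec (Fin q) m × Word K → Bool
    κ r (s , h) = does (hash s (f r) falses ≟ʷ h)

    κ′ : B → Vec (Fin q) m × Word K → Bool
    κ′ c (s , h) = does (hash s (g c) trues ≟ʷ h)

    -- A word has just one hash for each of the `q ^ m` seeds.
    few : ∀ (x : Vec (Fin q) m → Word K) →
          size hashes (λ (s , h) → does (x s ≟ʷ h)) ≤ q ^ m
    few x = begin
      size hashes (λ (s , h) → does (x s ≟ʷ h))
        ≡⟨ ∑-cartesianProductWith _,_ (seeds q m) (words K) _ ⟩
      ∑[ s ∈ seeds q m ] size (words K) (λ h → does (x s ≟ʷ h))
        ≤⟨ ∑-mono (seeds q m) (λ {s} _ → size≤1 (words-unique K) λ {h} {h′} e e′ →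
             trans (sym (does⁻ (x s ≟ʷ h) e)) (does⁻ (x s ≟ʷ h′) e′)) ⟩
      ∑[ _ ∈ seeds q m ] 1
        ≡⟨ trans (∑-seeds-const q m 1) (*-identityʳ _) ⟩
      q ^ m ∎
      where open ≤-Reasoning

  -- The number of keys per word, `q ^ m`, grows with the word length, but distant words collide for
  -- a fraction at least `1 / q ^ K` of the seeds, and only this fraction enters the bound.
  far-coverable : Coverable far (suc (suc k) ^ suc k)
  far-coverable = shared-keys⇒coverable hashes κ κ′ far {q ^ m} {q ^ K} (λ {r} {c} {sh} → sound {r} {c} {sh})
    (λ {r} _ → few (λ s → hash s (f r) falses))
    (λ {c} _ → few (λ s → hash s (g c) trues))
    many
    where
    sound : ∀ {r c sh} → κ r sh ≡ true → κ′ c sh ≡ true → far r c ≡ true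
    sound {r} {c} {s , h} κr κc = cong not (dec-false (hamming (f r) (g c) ≤? k) (<⇒≱ (begin
      K                            ≡⟨ hamming-replicate K ⟨
      hamming falses trues           ≤⟨ hash-differ s (f r) (g c) falses trues ⟩
      hamming (f r) (g c) + hamming (hash s (f r) falses) (hash s (g c) trues)
        ≡⟨ cong (hamming (f r) (g c) +_) (cong₂ hamming (does⁻ (hash s (f r) falses ≟ʷ h) κr) (does⁻ (hash s (g c) trues ≟ʷ h) κc)) ⟩
      hamming (f r) (g c) + hamming h h
        ≡⟨ trans (cong (hamming (f r) (g c) +_) (hamming-refl h)) (+-identityʳ _) ⟩
      hamming (f r) (g c) ∎)))
      where open ≤-Reasoning
    many : ∀ {r c} → r ∈ rows → c ∈ cols → far r c ≡ true →
           q ^ m ≤ q ^ K * size hashes (λ sh → κ r sh ∧ κ′ c sh)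
    many {r} {c} _ _ distant = begin
      q ^ m
        ≤⟨ collisions-bound x y falses trues K (hamming≤length falses trues) K≤ (inj₂ ≤-refl) ⟩
      q ^ K * collisions x y falses trues
        ≤⟨ *-monoʳ-≤ (q ^ K) (∑-mono (seeds q m) λ {s} _ → common s) ⟩
      q ^ K * (∑[ s ∈ seeds q m ] ∑[ h ∈ words K ] bit (κ r (s , h) ∧ κ′ c (s , h)))
        ≡⟨ cong (q ^ K *_) (∑-cartesianProductWith _,_ (seeds q m) (words K) _) ⟨
      q ^ K * size hashes (λ sh → κ r sh ∧ κ′ c sh) ∎
      where
      open ≤-Reasoning
      x = f r
      y = g c
      K≤ : K ≤ hamming x y
      K≤ = ≰⇒> λ ≤k → contradiction
        (trans (sym distant) (cong not (dec-true (hamming x y ≤? k) ≤k))) λ ()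
      common : ∀ s → bit (collide x y falses trues s) ≤
                     ∑[ h ∈ words K ] bit (κ r (s , h) ∧ κ′ c (s , h))
      common s = ≤-trans (bit-mono agree)
        (∈⇒≤∑ (λ h → bit (κ r (s , h) ∧ κ′ c (s , h))) (words-complete (hash s x falses)))
        where
        agree : collide x y falses trues s ≡ true →
                κ r (s , hash s x falses) ∧ κ′ c (s , hash s x falses) ≡ true
        agree e = ∧⁺ (dec-true (hash s x falses ≟ʷ hash s x falses) refl)
          (dec-true (hash s y trues ≟ʷ hash s x falses) (sym (does⁻ (hash s x falses ≟ʷ hash s y trues) e)))

-- Incidences of points and lines

open import Data.Integer using (+_)

bits : ∀ n → ℕ → Word n
bits zero    v = []
bits (suc n) v = if does (2 ^ n ≤? v) then true ∷ bits n (v ∸ 2 ^ n) else false ∷ bits n v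

unsigned-bits : ∀ n v → v < 2 ^ n → unsigned (bits n v) ≡ v
unsigned-bits zero    zero v< = refl
unsigned-bits zero    (suc v) (s≤s ())
unsigned-bits (suc n) v v< with 2 ^ n ≤? v
... | yes ≤v rewrite dec-true (2 ^ n ≤? v) ≤v = begin
  1 * 2 ^ n + unsigned (bits n (v ∸ 2 ^ n))  ≡⟨ cong₂ _+_ (*-identityˡ (2 ^ n)) (unsigned-bits n (v ∸ 2 ^ n) rest<) ⟩
  2 ^ n + (v ∸ 2 ^ n)                        ≡⟨ m+[n∸m]≡n ≤v ⟩
  v                                          ∎
  where
  open ≡-Reasoning
  rest< : v ∸ 2 ^ n < 2 ^ n
  rest< = m<n+o⇒m∸n<o v (2 ^ n) {{m^n≢0 2 n}} (<-≤-trans v< (≤-reflexive (cong (λ x → 2 ^ n + x) (+-identityʳ _))))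
... | no ≰v rewrite dec-false (2 ^ n ≤? v) ≰v = unsigned-bits n v (≰⇒> ≰v)

unsigned-all-ones : ∀ n → suc (unsigned (replicate n true)) ≡ 2 ^ n
unsigned-all-ones zero    = refl
unsigned-all-ones (suc n) = begin
  suc (1 * 2 ^ n + unsigned (replicate n true))    ≡⟨ +-suc (1 * 2 ^ n) _ ⟨
  1 * 2 ^ n + suc (unsigned (replicate n true))    ≡⟨ cong₂ _+_ (*-identityˡ (2 ^ n)) (unsigned-all-ones n) ⟩
  2 ^ n + 2 ^ n                                    ≡⟨ cong (λ x → 2 ^ n + x) (+-identityʳ _) ⟨
  2 ^ suc n                                        ∎
  where open ≡-Reasoning

natural : ∀ p → ℕ → Word (suc p)
natural p v = false ∷ bits p v

signed-natural : ∀ p v → v < 2 ^ p → signed (natural p v) ≡ + v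
signed-natural p v v< = trans (ℤ.+-identityʳ _) (cong +_ (unsigned-bits p v v<))

signed-all-ones : ∀ p → signed (replicate (suc p) true) ≡ -1ℤ
signed-all-ones p = begin
  + u ℤ.- + (1 * 2 ^ p)     ≡⟨ cong (λ x → + u ℤ.- + x) (trans (*-identityˡ (2 ^ p)) (sym (unsigned-all-ones p))) ⟩
  + u ℤ.- (1ℤ ℤ.+ + u)      ≡⟨ cancel (+ u) ⟩
  -1ℤ                       ∎
  where
  open ≡-Reasoning
  u = unsigned (replicate p true)
  cancel : ∀ i → i ℤ.- (1ℤ ℤ.+ i) ≡ -1ℤ
  cancel = ℤ-Solver.solve-∀

concat-injective : ∀ {A : Set} {m n} (xss yss : Vec (Vec A m) n) → concat xss ≡ concat yss → xss ≡ yss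
concat-injective []         []         e = refl
concat-injective (xs ∷ xss) (ys ∷ yss) e =
  let p , q = Vec.++-injective xs ys e in cong₂ _∷_ p (concat-injective xss yss q)

-- The blocks returned by `group` come with a proof that they concatenate to the word, and
-- injectivity of `concat` identifies them.
decode-concat : ∀ d n (xss : Vec (Word n) d) → decode d n (concat xss) ≡ Vec.map signed xss
decode-concat d n xss = cong (Vec.map signed)
  (sym (concat-injective xss _ (proj₂ (group d n (concat xss)))))

⟨zero,_⟩ : ∀ {d} (v : Vec ℤ d) → ⟨ replicate d 0ℤ , v ⟩ ≡ 0ℤ
⟨zero, [] ⟩    = refl
⟨zero, x ∷ v ⟩ = trans (ℤ.+-identityˡ _) ⟨zero, v ⟩

length-cartesianProduct : ∀ {A B : Set} (xs : List A) (ys : List B) →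
  length (cartesianProduct xs ys) ≡ length xs * length ys
length-cartesianProduct []       ys = refl
length-cartesianProduct (x ∷ xs) ys = trans (length-++ (map (x ,_) ys))
  (cong₂ _+_ (length-map (x ,_) ys) (length-cartesianProduct xs ys))

-- Subtracting the two equations over the integers leaves `(a - a′)(u - u′) = 0`.
cross-cancel : ∀ a a′ u u′ {b b′} → a * u + b ≡ a′ * u + b′ → a * u′ + b ≡ a′ * u′ + b′ →
               a ≡ a′ ⊎ u ≡ u′
cross-cancel a a′ u u′ {b} {b′} e e′ with ℤ.i*j≡0⇒i≡0∨j≡0 (+ a ℤ.- + a′) product≡0
  where
  lift : ∀ x → a * x + b ≡ a′ * x + b′ → + a ℤ.* + x ℤ.+ + b ≡ + a′ ℤ.* + x ℤ.+ + b′
  lift x e = trans (cong (ℤ._+ + b) (sym (ℤ.pos-* a x))) (trans (cong +_ e) (cong (ℤ._+ + b′) (ℤ.pos-* a′ x)))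
  expand : ∀ a a′ u u′ b b′ → (a ℤ.- a′) ℤ.* (u ℤ.- u′) ≡
    ((a ℤ.* u ℤ.+ b) ℤ.- (a′ ℤ.* u ℤ.+ b′)) ℤ.- ((a ℤ.* u′ ℤ.+ b) ℤ.- (a′ ℤ.* u′ ℤ.+ b′))
  expand = ℤ-Solver.solve-∀
  product≡0 : (+ a ℤ.- + a′) ℤ.* (+ u ℤ.- + u′) ≡ 0ℤ
  product≡0 = trans (expand (+ a) (+ a′) (+ u) (+ u′) (+ b) (+ b′))
    (cong₂ ℤ._-_ (ℤ.i≡j⇒i-j≡0 (lift u e)) (ℤ.i≡j⇒i-j≡0 (lift u′ e′)))
... | inj₁ a-a′≡0 = inj₁ (ℤ.+-injective (ℤ.i-j≡0⇒i≡j (+ a) (+ a′) a-a′≡0))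
... | inj₂ u-u′≡0 = inj₂ (ℤ.+-injective (ℤ.i-j≡0⇒i≡j (+ u) (+ u′) u-u′≡0))

module _ (d p s : ℕ) (2s<p : s + s < p) where

  private
    S S² : ℕ
    S  = 2 ^ s
    S² = S * S

    -- The ordinate `a u + b` is less than `S² + S²`, so with `2 * S²` ordinates every line has a
    -- point over each abscissa.
    Point Line : Set
    Point = Fin S × Fin (2 * S²)
    Line  = Fin S × Fin S²

  points : List Point
  points = cartesianProduct (allFin S) (allFin (2 * S²))

  lines : List Line
  lines = cartesianProduct (allFin S) (allFin S²)

  open Rectangle points lines

  On : Point → Line → Set
  On (u , v) (a , b) = toℕ v ≡ toℕ a * toℕ u + toℕ b

  -- By `cross-cancel` the slopes or the abscissas agree; in the first case the intercepts agree
  -- too, in the second the ordinates.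
  two-lines-meet-once : ∀ {r r′ c c′} → r ≢ r′ → c ≢ c′ → On r c → On r c′ → On r′ c → ¬ On r′ c′
  two-lines-meet-once {u , v} {u′ , v′} {a , b} {a′ , b′} r≢r′ c≢c′ rc rc′ r′c r′c′
    with cross-cancel (toℕ a) (toℕ a′) (toℕ u) (toℕ u′) (trans (sym rc) rc′) (trans (sym r′c) r′c′)
  ... | inj₁ a≡a′ = c≢c′ (cong₂ _,_ (toℕ-injective a≡a′) (toℕ-injective
    (+-cancelˡ-≡ (toℕ a * toℕ u) _ _ (trans (trans (sym rc) rc′) (cong (λ x → x * toℕ u + toℕ b′) (sym a≡a′))))))
  ... | inj₂ u≡u′ = r≢r′ (cong₂ _,_ (toℕ-injective u≡u′) (toℕ-injective
    (trans rc (trans (cong (λ x → toℕ a * x + toℕ b) u≡u′) (sym r′c)))))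

  private
    -- Incidence as orthogonality: the vectors `(u, 1, v)` and `(a, b, -1)` have inner product
    -- `a u + b - v`. The remaining `d` coordinates are padded with zeros.
    point-blocks : Fin S → Fin (2 * S²) → Vec (Word (suc p)) (3 + d)
    point-blocks u v = natural p (toℕ u) ∷ natural p 1 ∷ natural p (toℕ v) ∷ replicate d (natural p 0)

    line-blocks : Fin S → Fin S² → Vec (Word (suc p)) (3 + d)
    line-blocks a b = natural p (toℕ a) ∷ natural p (toℕ b) ∷ replicate (suc p) true ∷ replicate d (natural p 0)

  point : Point → Word ((3 + d) * suc p)
  point (u , v) = concat (point-blocks u v)

  line : Line → Word ((3 + d) * suc p)
  line (a , b) = concat (line-blocks a b)

  private
    2S²≤2^p : 2 * S² ≤ 2 ^ p
    2S²≤2^p = begin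
      2 * (2 ^ s * 2 ^ s)  ≡⟨ cong (2 *_) (^-distribˡ-+-* 2 s s) ⟨
      2 ^ suc (s + s)      ≤⟨ ^-monoʳ-≤ 2 2s<p ⟩
      2 ^ p                ∎
      where open ≤-Reasoning

    1≤S : 1 ≤ S
    1≤S = m^n>0 2 s

    S≤S² : S ≤ S²
    S≤S² = ≤-trans (≤-reflexive (sym (*-identityˡ S))) (*-monoˡ-≤ S 1≤S)

    S²≤2S² : S² ≤ 2 * S²
    S²≤2S² = m≤m+n S² _

    small : ∀ {v N} → v < N → N ≤ 2 * S² → signed (natural p v) ≡ + v
    small v< N≤ = signed-natural p _ (<-≤-trans v< (≤-trans N≤ 2S²≤2^p))

    1≤S² : 1 ≤ S²
    1≤S² = ≤-trans 1≤S S≤S²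

    signed-0 : signed (natural p 0) ≡ 0ℤ
    signed-0 = small {0} {S²} 1≤S² S²≤2S²

    decode-point : ∀ u v → decode (3 + d) (suc p) (point (u , v)) ≡
                   + toℕ u ∷ 1ℤ ∷ + toℕ v ∷ replicate d 0ℤ
    decode-point u v = trans (decode-concat (3 + d) (suc p) (point-blocks u v))
      (cong₂ _∷_ (small (toℕ<n u) (≤-trans S≤S² S²≤2S²))
      (cong₂ _∷_ (small {1} {2} ≤-refl (*-monoʳ-≤ 2 1≤S²))
      (cong₂ _∷_ (small (toℕ<n v) ≤-refl)
      (trans (Vec.map-replicate signed (natural p 0) d) (cong (replicate d) signed-0)))))

    decode-line : ∀ a b → decode (3 + d) (suc p) (line (a , b)) ≡
                  + toℕ a ∷ + toℕ b ∷ -1ℤ ∷ replicate d 0ℤ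
    decode-line a b = trans (decode-concat (3 + d) (suc p) (line-blocks a b))
      (cong₂ _∷_ (small (toℕ<n a) (≤-trans S≤S² S²≤2S²))
      (cong₂ _∷_ (small (toℕ<n b) S²≤2S²)
      (cong₂ _∷_ (signed-all-ones p)
      (trans (Vec.map-replicate signed (natural p 0) d) (cong (replicate d) signed-0)))))

  ⟨point,line⟩ : ∀ u v a b →
    ⟨ decode (3 + d) (suc p) (point (u , v)) , decode (3 + d) (suc p) (line (a , b)) ⟩ ≡
    + (toℕ a * toℕ u + toℕ b) ℤ.- + toℕ v
  ⟨point,line⟩ u v a b = begin
    ⟨ decode (3 + d) (suc p) (point (u , v)) , decode (3 + d) (suc p) (line (a , b)) ⟩
      ≡⟨ cong₂ ⟨_,_⟩ (decode-point u v) (decode-line a b) ⟩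
    + toℕ u ℤ.* + toℕ a ℤ.+ (1ℤ ℤ.* + toℕ b ℤ.+ (+ toℕ v ℤ.* -1ℤ ℤ.+ ⟨ replicate d 0ℤ , replicate d 0ℤ ⟩))
      ≡⟨ cong (λ z → + toℕ u ℤ.* + toℕ a ℤ.+ (1ℤ ℤ.* + toℕ b ℤ.+ (+ toℕ v ℤ.* -1ℤ ℤ.+ z))) ⟨zero, replicate d 0ℤ ⟩ ⟩
    + toℕ u ℤ.* + toℕ a ℤ.+ (1ℤ ℤ.* + toℕ b ℤ.+ (+ toℕ v ℤ.* -1ℤ ℤ.+ 0ℤ))
      ≡⟨ rearrange (+ toℕ u) (+ toℕ a) (+ toℕ b) (+ toℕ v) ⟩
    + toℕ a ℤ.* + toℕ u ℤ.+ + toℕ b ℤ.- + toℕ v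
      ≡⟨ cong (λ z → z ℤ.+ + toℕ b ℤ.- + toℕ v) (ℤ.pos-* (toℕ a) (toℕ u)) ⟨
    + (toℕ a * toℕ u + toℕ b) ℤ.- + toℕ v ∎
    where
    open ≡-Reasoning
    rearrange : ∀ u a b v → u ℤ.* a ℤ.+ (1ℤ ℤ.* b ℤ.+ (v ℤ.* -1ℤ ℤ.+ 0ℤ)) ≡ a ℤ.* u ℤ.+ b ℤ.- v
    rearrange = ℤ-Solver.solve-∀

  private
    iip : Point → Line → Bool
    iip r c = matrix (IIP (3 + d)) (suc p) (point r) (line c)

  iip-on : ∀ r c → On r c → not (iip r c) ≡ true
  iip-on (u , v) (a , b) on = cong (not ∘ not) (dec-true (_ ℤ.≟ 0ℤ)
    (trans (⟨point,line⟩ u v a b) (ℤ.i≡j⇒i-j≡0 (cong +_ (sym on)))))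

  on-iip : ∀ r c → not (iip r c) ≡ true → On r c
  on-iip (u , v) (a , b) e = sym (ℤ.+-injective (ℤ.i-j≡0⇒i≡j _ _
    (trans (sym (⟨point,line⟩ u v a b)) (does⁻ (_ ℤ.≟ 0ℤ) (trans (sym (not-involutive _)) e)))))

  private
    length-points : length points ≡ S * (2 * S²)
    length-points = trans (length-cartesianProduct (allFin S) (allFin (2 * S²)))
      (cong₂ _*_ (length-allFin S) (length-allFin (2 * S²)))

    length-lines : length lines ≡ S * S²
    length-lines = trans (length-cartesianProduct (allFin S) (allFin S²))
      (cong₂ _*_ (length-allFin S) (length-allFin S²))

    size-all : ∀ {A : Set} (xs : List A) → size xs (λ _ → true) ≡ length xs
    size-all xs = trans (∑-const xs 1) (*-identityʳ _)

    size-points : size points (λ _ → true) ≡ S * (2 * S²)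
    size-points = trans (size-all points) length-points

    size-lines : size lines (λ _ → true) ≡ S * S²
    size-lines = trans (size-all lines) length-lines

    three : ∀ x y → x * (2 * y) + x * y ≡ 3 * (x * y)
    three = solve-∀

  -- Each of the `S` abscissas and each of the `S * S²` lines determine a point of the grid on that
  -- line.
  many-incidences : ∀ (w : Point → Line → Bool) → (∀ r c → On r c → w r c ≡ true) →
                    S * (S * S²) ≤ pairs (λ _ → true) (λ _ → true) w
  many-incidences w on⇒w = begin
    S * (S * S²)
      ≡⟨ cong₂ _*_ (length-allFin S) size-lines ⟨
    length (allFin S) * size lines (λ _ → true)
      ≡⟨ ∑-const (allFin S) _ ⟨
    ∑[ u ∈ allFin S ] ∑[ c ∈ lines ] 1
      ≤⟨ ∑-mono (allFin S) (λ {u} _ → ∑-mono lines λ {c} _ → hit u c) ⟩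
    ∑[ u ∈ allFin S ] ∑[ c ∈ lines ] ∑[ v ∈ allFin (2 * S²) ] bit (w (u , v) c)
      ≡⟨ ∑-cong (allFin S) (λ u → ∑-swap lines (allFin (2 * S²)) _) ⟩
    ∑[ u ∈ allFin S ] ∑[ v ∈ allFin (2 * S²) ] ∑[ c ∈ lines ] bit (w (u , v) c)
      ≡⟨ ∑-cartesianProductWith _,_ (allFin S) (allFin (2 * S²)) _ ⟨
    pairs (λ _ → true) (λ _ → true) w ∎
    where
    open ≤-Reasoning
    hit : ∀ u c → 1 ≤ ∑[ v ∈ allFin (2 * S²) ] bit (w (u , v) c)
    hit u c@(a , b) = begin
      1                   ≡⟨ cong bit (on⇒w (u , v) c (toℕ-fromℕ< v<)) ⟨
      bit (w (u , v) c)   ≤⟨ ∈⇒≤∑ (λ v → bit (w (u , v) c)) (∈-allFin v) ⟩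
      ∑[ v ∈ allFin (2 * S²) ] bit (w (u , v) c) ∎
      where
      v< : toℕ a * toℕ u + toℕ b < 2 * S²
      v< = ≤-trans (+-mono-≤-< (*-mono-≤ (<⇒≤ (toℕ<n a)) (<⇒≤ (toℕ<n u))) (toℕ<n b))
             (≤-reflexive (cong (λ x → S² + x) (sym (+-identityʳ S²))))
      v = fromℕ< v<

  private
    -- There are `3 S³` points and lines together, fewer than `4 S³`, which is this power of two.
    Λ : ℕ
    Λ = 2 + (s + (s + s))

    few-indices : length points + length lines < 2 ^ Λ
    few-indices = begin-strict
      length points + length lines
        ≡⟨ cong₂ _+_ length-points length-lines ⟩
      S * (2 * S²) + S * S²
        ≡⟨ three S S² ⟩
      3 * (S * S²)
        <⟨ *-monoˡ-< (S * S²) {{>-nonZero (*-mono-≤ 1≤S 1≤S²)}} (≤-refl {4}) ⟩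
      4 * (S * S²)
        ≡⟨ cong (4 *_) (trans (^-distribˡ-+-* 2 s (s + s)) (cong (S *_) (^-distribˡ-+-* 2 s s))) ⟨
      4 * 2 ^ (s + (s + s))
        ≡⟨ *-assoc 2 2 (2 ^ (s + (s + s))) ⟩
      2 ^ Λ ∎
      where
      open ≤-Reasoning

  module _ {k : ℕ} (T : Protocol (THD k) (Word ((3 + d) * suc p)))
           (T-computes : Computes T (matrix (IIP (3 + d)) (suc p)))
           {W : ℕ} .{{_ : NonZero W}} (W≥ : suc k * suc Λ ^ k + suc (suc k) ^ suc k ≤ W)
    where

    -- The zeros of `T` are the incidences, at least `S⁴` in number, while the perimeter is `3 S³`;
    -- the common `S³` cancels.
    protocol-bound : 2 ^ s ≤ W ^ cost T * 3
    protocol-bound = *-cancelʳ-≤ S (W ^ cost T * 3) (S * S²) {{>-nonZero (*-mono-≤ 1≤S 1≤S²)}} (begin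
      S * (S * S²)
        ≤⟨ many-incidences (λ r c → not (run T (point r) (line c)))
             (λ r c on → trans (cong not (T-computes (point r) (line c))) (iip-on r c on)) ⟩
      pairs (λ _ → true) (λ _ → true) (λ r c → not (run T (point r) (line c)))
        ≤⟨ zeros-bound (Unique.cartesianProduct⁺ (Unique.allFin⁺ S) (Unique.allFin⁺ (2 * S²)))
             (Unique.cartesianProduct⁺ (Unique.allFin⁺ S) (Unique.allFin⁺ S²))
             On two-lines-meet-once point line {THD k} {suc k * suc Λ ^ k} {suc (suc k) ^ suc k} W≥ ones-coverable zeros-coverable T _ _
             (λ r c _ _ e → on-iip r c (trans (cong not (sym (T-computes (point r) (line c)))) e)) ⟩
      W ^ cost T * perimeter (λ _ → true) (λ _ → true)
        ≡⟨ cong (W ^ cost T *_) (trans (cong₂ _+_ size-points size-lines) (three S S²)) ⟩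
      W ^ cost T * (3 * (S * S²))
        ≡⟨ *-assoc (W ^ cost T) 3 _ ⟨
      W ^ cost T * 3 * (S * S²) ∎)
      where
      open ≤-Reasoning
      ones-coverable : ∀ {Q : Matrix _ _} → QS (THD k) Q →
        Coverable (λ r c → Q (point r) (line c)) (suc k * suc Λ ^ k)
      ones-coverable q with QS⇒reindexing q
      ... | m , f , g , eq = coverable-resp (suc k * suc Λ ^ k) (λ r c → sym (eq (point r) (line c)))
        (near-coverable points lines (f ∘ point) (g ∘ line) k Λ few-indices)
      zeros-coverable : ∀ {Q : Matrix _ _} → QS (THD k) Q →
        Coverable (λ r c → not (Q (point r) (line c))) (suc (suc k) ^ suc k)
      zeros-coverable q with QS⇒reindexing q
      ... | m , f , g , eq = coverable-resp (suc (suc k) ^ suc k) (λ r c → cong not (sym (eq (point r) (line c))))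
        (far-coverable points lines (f ∘ point) (g ∘ line) k)

-- Asymptotics

2^≤⇒≤log : ∀ {j n} → 2 ^ j ≤ n → j ≤ ⌊log₂ n ⌋
2^≤⇒≤log {j} 2^j≤n = ≤-trans (≤-reflexive (sym (⌊log₂[2^n]⌋≡n j))) (⌊log₂⌋-mono-≤ 2^j≤n)

log→∞ : ⌊log₂_⌋ →∞
log→∞ B = 2 ^ B , λ n → 2^≤⇒≤log

n<2^[1+log] : ∀ n → n < 2 ^ suc ⌊log₂ n ⌋
n<2^[1+log] n = ≰⇒> λ 2^≤n → contradiction (2^≤⇒≤log {suc ⌊log₂ n ⌋} 2^≤n) (<⇒≱ ≤-refl)

2^log≤n : ∀ n → 1 ≤ n → 2 ^ ⌊log₂ n ⌋ ≤ n
2^log≤n n = by-log ⌊log₂ n ⌋ n refl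
  where
  open ≤-Reasoning
  by-log : ∀ L n → ⌊log₂ n ⌋ ≡ L → 1 ≤ n → 2 ^ L ≤ n
  by-log zero    n             e 1≤n = 1≤n
  by-log (suc L) (suc (suc n)) e _   = begin
    2 * 2 ^ L                    ≤⟨ *-monoʳ-≤ 2 (by-log L half (trans (⌊log₂⌊n/2⌋⌋≡⌊log₂n⌋∸1 (suc (suc n))) (cong (_∸ 1) e)) (s≤s z≤n)) ⟩
    2 * half                     ≡⟨ cong (λ x → half + x) (+-identityʳ half) ⟩
    half + half                  ≤⟨ +-monoʳ-≤ half (⌊n/2⌋≤⌈n/2⌉ (suc (suc n))) ⟩
    half + ⌈ suc (suc n) /2⌉     ≡⟨ ⌊n/2⌋+⌈n/2⌉≡n (suc (suc n)) ⟩
    suc (suc n)                  ∎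
    where half = ⌊ suc (suc n) /2⌋

-- The inequality 3·2^((1 + (2 + L)(k + 1))c) ≥ 2^s from the incidence count,
-- with s = ⌊(n - 2)/2⌋ and every base occurring in W at most 2^(2 + L).
cost-bound : ∀ d n k c → 14 ≤ n → k ≤ n → D[ THD k ] (matrix (IIP (3 + d)) n) ≐ c →
             n ≤ 8 * suc k * (⌊log₂ n ⌋ * c)
cost-bound d (suc zero) k c (s≤s ())
cost-bound d (suc (suc p)) k c 14≤n k≤n D with D[_]_≐_.attained D
... | T , T-computes , refl = +-cancelˡ-≤ 14 _ _ (begin
  -- Doubling `n ≤ 7 + 4 (E c)` yields the additive constant 14, which the second copy of `n`
  -- absorbs.
  14 + n                                       ≤⟨ +-monoˡ-≤ n 14≤n ⟩
  n + n                                        ≤⟨ +-mono-≤ n≤ n≤ ⟩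
  7 + 4 * (E * c) + (7 + 4 * (E * c))          ≡⟨ final L (suc k) c ⟩
  14 + 8 * suc k * (L * c)                     ∎)
  where
  open ≤-Reasoning
  n = suc (suc p)
  L = ⌊log₂ n ⌋
  ℓ = 2 + L
  -- A block of `n` bits has `suc p` bits below its sign bit, and `protocol-bound` asks for
  -- `s + s < suc p`.
  s = ⌊ p /2⌋
  E = L * suc k
  e = suc (ℓ * suc k)

  final : ∀ L k c → 7 + 4 * (L * k * c) + (7 + 4 * (L * k * c)) ≡ 14 + 8 * k * (L * c)
  final = solve-∀

  3≤L : 3 ≤ L
  3≤L = 2^≤⇒≤log {3} (≤-trans (m≤m+n 8 6) 14≤n)

  2s≤p : s + s ≤ p
  2s≤p = ≤-trans (+-monoʳ-≤ s (⌊n/2⌋≤⌈n/2⌉ p)) (≤-reflexive (⌊n/2⌋+⌈n/2⌉≡n p))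

  p≤1+2s : p ≤ suc (s + s)
  p≤1+2s = begin
    p                    ≡⟨ ⌊n/2⌋+⌈n/2⌉≡n p ⟨
    s + ⌈ p /2⌉          ≤⟨ +-monoʳ-≤ s (⌊n/2⌋-mono (n≤1+n (suc p))) ⟩
    s + suc s            ≡⟨ +-suc s s ⟩
    suc (s + s)          ∎

  2n≤2^ℓ : n + n ≤ 2 ^ ℓ
  2n≤2^ℓ = begin
    n + n                ≡⟨ cong (λ x → n + x) (+-identityʳ n) ⟨
    2 * n                ≤⟨ *-monoʳ-≤ 2 (<⇒≤ (n<2^[1+log] n)) ⟩
    2 ^ ℓ                ∎

  Λ<2^ℓ : 3 + (s + (s + s)) ≤ 2 ^ ℓ
  Λ<2^ℓ = begin
    3 + (s + (s + s))    ≤⟨ +-monoʳ-≤ 3 (+-mono-≤ (≤-trans (m≤m+n s s) 2s≤p) 2s≤p) ⟩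
    3 + (p + p)          ≤⟨ n≤1+n _ ⟩
    4 + (p + p)          ≡⟨ double p ⟩
    n + n                ≤⟨ 2n≤2^ℓ ⟩
    2 ^ ℓ                ∎
    where
    double : ∀ p → 4 + (p + p) ≡ suc (suc p) + suc (suc p)
    double = solve-∀

  k+2≤2^ℓ : suc (suc k) ≤ 2 ^ ℓ
  k+2≤2^ℓ = ≤-trans (+-mono-≤ (≤-trans (s≤s (s≤s z≤n)) 14≤n) k≤n) 2n≤2^ℓ

  W≥ : suc k * suc (2 + (s + (s + s))) ^ k + suc (suc k) ^ suc k ≤ 2 ^ e
  W≥ = begin
    suc k * suc (2 + (s + (s + s))) ^ k + suc (suc k) ^ suc k
      ≤⟨ +-mono-≤ (*-mono-≤ (≤-trans (n≤1+n _) k+2≤2^ℓ) (^-monoˡ-≤ k Λ<2^ℓ)) (^-monoˡ-≤ (suc k) k+2≤2^ℓ) ⟩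
    (2 ^ ℓ) ^ suc k + (2 ^ ℓ) ^ suc k
      ≡⟨ cong (λ x → (2 ^ ℓ) ^ suc k + x) (+-identityʳ _) ⟨
    2 * (2 ^ ℓ) ^ suc k
      ≡⟨ cong (2 *_) (^-*-assoc 2 ℓ (suc k)) ⟩
    2 ^ e ∎

  s≤ : s ≤ 2 + e * c
  s≤ = ≤-trans (2^≤⇒≤log (begin
    2 ^ s                    ≤⟨ protocol-bound d (suc p) s (s≤s 2s≤p) T T-computes {2 ^ e} {{m^n≢0 2 e}} W≥ ⟩
    -- The 3 is rounded up to a power of two, which adds 2 to the exponent.
    (2 ^ e) ^ c * 3          ≤⟨ *-monoʳ-≤ ((2 ^ e) ^ c) (n≤1+n 3) ⟩
    (2 ^ e) ^ c * 4          ≡⟨ *-comm ((2 ^ e) ^ c) 4 ⟩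
    4 * (2 ^ e) ^ c          ≡⟨ cong (4 *_) (^-*-assoc 2 e c) ⟩
    4 * 2 ^ (e * c)          ≡⟨ ^-distribˡ-+-* 2 2 (e * c) ⟨
    2 ^ (2 + e * c)          ∎)) (≤-reflexive (⌊log₂[2^n]⌋≡n (2 + e * c)))

  e≤ : e ≤ 2 * E
  e≤ = begin
    -- The leading 1 is at most `suc k`, and `3 ≤ L` trades the resulting 3 for a second `L`.
    suc (ℓ * suc k)          ≤⟨ +-monoˡ-≤ (ℓ * suc k) (s≤s (z≤n {k})) ⟩
    (3 + L) * suc k          ≤⟨ *-monoˡ-≤ (suc k) (+-monoˡ-≤ L 3≤L) ⟩
    (L + L) * suc k          ≡⟨ twice L (suc k) ⟩
    2 * E                    ∎
    where
    twice : ∀ L k → (L + L) * k ≡ 2 * (L * k)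
    twice = solve-∀

  n≤ : n ≤ 7 + 4 * (E * c)
  n≤ = begin
    2 + p                                        ≤⟨ +-monoʳ-≤ 2 p≤1+2s ⟩
    3 + (s + s)                                  ≤⟨ +-monoʳ-≤ 3 (+-mono-≤ s≤ s≤) ⟩
    3 + (2 + e * c + (2 + e * c))                ≤⟨ +-monoʳ-≤ 3 (+-mono-≤ (+-monoʳ-≤ 2 ec≤) (+-monoʳ-≤ 2 ec≤)) ⟩
    3 + (2 + 2 * E * c + (2 + 2 * E * c))        ≡⟨ collect E c ⟩
    7 + 4 * (E * c)                              ∎
    where
    ec≤ = *-monoˡ-≤ c e≤
    collect : ∀ E c → 3 + (2 + 2 * E * c + (2 + 2 * E * c)) ≡ 7 + 4 * (E * c)
    collect = solve-∀

-- Exponents that tend to infinity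

quadratic≤exponential : ∀ i → (6 + i) * (5 + i) ≤ 2 ^ (5 + i)
quadratic≤exponential zero    = m≤m+n 30 2
quadratic≤exponential (suc i) = begin
  (6 + suc i) * (5 + suc i)                  ≤⟨ m≤m+n _ _ ⟩
  (6 + suc i) * (5 + suc i) + (3 + i) * (6 + i) ≡⟨ step i ⟩
  2 * ((6 + i) * (5 + i))                    ≤⟨ *-monoʳ-≤ 2 (quadratic≤exponential i) ⟩
  2 ^ (5 + suc i)                            ∎
  where
  open ≤-Reasoning
  step : ∀ i → (6 + suc i) * (5 + suc i) + (3 + i) * (6 + i) ≡ 2 * ((6 + i) * (5 + i))
  step = solve-∀

-- With `j` the logarithm of `L`, the left side is at most 2 to the power `(j + 1) j`, and
-- `(j + 1) j` is at most `2 ^ j` and so at most `L`. The bound 32 ensures `5 ≤ j`.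
log^loglog≤ : ∀ L → 32 ≤ L → L ^ ⌊log₂ L ⌋ ≤ 2 ^ L
log^loglog≤ L 32≤L = begin
  L ^ j                  ≤⟨ ^-monoˡ-≤ j (<⇒≤ (n<2^[1+log] L)) ⟩
  (2 ^ suc j) ^ j        ≡⟨ ^-*-assoc 2 (suc j) j ⟩
  2 ^ (suc j * j)        ≤⟨ ^-monoʳ-≤ 2 (≤-trans exponent (2^log≤n L (≤-trans (s≤s z≤n) 32≤L))) ⟩
  2 ^ L                  ∎
  where
  open ≤-Reasoning
  j = ⌊log₂ L ⌋
  exponent : suc j * j ≤ 2 ^ j
  exponent with m≤n⇒∃[o]m+o≡n (2^≤⇒≤log {5} 32≤L)
  ... | i , 5+i≡j = subst (λ j → suc j * j ≤ 2 ^ j) 5+i≡j (quadratic≤exponential i)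

loglog : ℕ → ℕ
loglog n = ⌊log₂ ⌊log₂ n ⌋ ⌋

-- The cap by loglog n keeps (log n)^exponent below n, which is needed where k n = 0.
exponent : (ℕ → ℕ) → ℕ → ℕ
exponent h n = h n ⊓ loglog n ∸ 2

exponent→∞ : ∀ {h} → h →∞ → exponent h →∞
exponent→∞ {h} h→∞ B with h→∞ (B + 2)
-- The target is raised by 2 to make up for the subtraction, and the threshold is doubly exponential
-- because of the iterated logarithm.
... | N , above = N ⊔ 2 ^ (2 ^ (B + 2)) , λ n N≤n → m+n≤o⇒m≤o∸n B
  (⊓-glb (above n (m⊔n≤o⇒m≤o N _ N≤n)) (2^≤⇒≤log (2^≤⇒≤log (m⊔n≤o⇒n≤o N _ N≤n))))

-- The two spare factors `L` explain the 2 subtracted in `exponent`: one cancels the logarithm in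
-- `upper`, the other absorbs the constant 16 left by `suc k ≤ k + k`.
cancel-log : ∀ {L g c x} k .{{_ : NonZero k}} → 16 ≤ L → k * L ^ (2 + g) ≤ x →
             x ≤ 8 * suc k * (L * c) → L ^ g ≤ c
cancel-log {L} {g} {c} {x} k 16≤L lower upper = *-cancelˡ-≤ L (*-cancelˡ-≤ L (*-cancelˡ-≤ k (begin
  k * L ^ (2 + g)                ≤⟨ lower ⟩
  x                              ≤⟨ upper ⟩
  8 * suc k * (L * c)            ≤⟨ *-monoˡ-≤ (L * c) (*-monoʳ-≤ 8 (+-monoˡ-≤ k (>-nonZero⁻¹ k))) ⟩
  8 * (k + k) * (L * c)          ≡⟨ regroup k (L * c) ⟩
  k * (16 * (L * c))             ≤⟨ *-monoʳ-≤ k (*-monoˡ-≤ (L * c) 16≤L) ⟩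
  k * (L * (L * c))              ∎)))
  where
  open ≤-Reasoning
  instance
    L≢0 : NonZero L
    L≢0 = >-nonZero (≤-trans (s≤s z≤n) 16≤L)
  regroup : ∀ k y → 8 * (k + k) * y ≡ k * (16 * y)
  regroup = solve-∀

theorem4p2 : ∀ (d : ℕ) → 3 ≤ d →
    (∀ (k : ℕ → ℕ) → k ≤n/log^ω1 →
    ∃[ g ] g →∞ × Eventually λ n → ∀ c →
    D[ THD (k n) ] (matrix (IIP d) n) ≐ c → ⌊log₂ n ⌋ ^ g n ≤ c)
    ×
    (∀ (k : ℕ) →
    ∃[ K ] 1 ≤ K × Eventually λ n → ∀ c →
    D[ THD k ] (matrix (IIP d) n) ≐ c → n ≤ K * (⌊log₂ n ⌋ * c))
theorem4p2 (suc (suc (suc d))) (s≤s (s≤s (s≤s _))) = growing , constant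
  where
  constant : ∀ k → ∃[ K ] 1 ≤ K × Eventually λ n → ∀ c →
    D[ THD k ] (matrix (IIP (3 + d)) n) ≐ c → n ≤ K * (⌊log₂ n ⌋ * c)
  -- The threshold includes `k` because `cost-bound` requires `k ≤ n`.
  constant k = 8 * suc k , s≤s z≤n , 14 ⊔ k , λ n N≤n c →
    cost-bound d n k c (m⊔n≤o⇒m≤o 14 k N≤n) (m⊔n≤o⇒n≤o 14 k N≤n)

  growing : ∀ k → k ≤n/log^ω1 → ∃[ g ] g →∞ × Eventually λ n → ∀ c →
    D[ THD (k n) ] (matrix (IIP (3 + d)) n) ≐ c → ⌊log₂ n ⌋ ^ g n ≤ c
  growing k (h , h→∞ , N₁ , small) = exponent h , exponent→∞ h→∞ , eventually (h→∞ 2) (log→∞ 32)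
    where
    eventually : Eventually (λ n → 2 ≤ h n) → Eventually (λ n → 32 ≤ ⌊log₂ n ⌋) →
      Eventually λ n → ∀ c → D[ THD (k n) ] (matrix (IIP (3 + d)) n) ≐ c → ⌊log₂ n ⌋ ^ exponent h n ≤ c
    eventually (N₂ , 2≤h) (N₃ , 32≤log) = N₁ ⊔ (N₂ ⊔ (N₃ ⊔ 14)) , λ n N≤n c D → bound n N≤n c D
      where
      bound : ∀ n → N₁ ⊔ (N₂ ⊔ (N₃ ⊔ 14)) ≤ n → ∀ c →
        D[ THD (k n) ] (matrix (IIP (3 + d)) n) ≐ c → ⌊log₂ n ⌋ ^ exponent h n ≤ c
      bound n N≤n c D = finish (k n) (small n N₁≤n) (cost-bound d n (k n) c 14≤n k≤n D)
        where
        open ≤-Reasoning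
        L = ⌊log₂ n ⌋
        N₁≤n : N₁ ≤ n
        N₁≤n = m⊔n≤o⇒m≤o N₁ _ N≤n
        N₂≤n : N₂ ≤ n
        N₂≤n = m⊔n≤o⇒m≤o N₂ _ (m⊔n≤o⇒n≤o N₁ _ N≤n)
        rest≤n : N₃ ⊔ 14 ≤ n
        rest≤n = m⊔n≤o⇒n≤o N₂ _ (m⊔n≤o⇒n≤o N₁ _ N≤n)
        14≤n : 14 ≤ n
        14≤n = m⊔n≤o⇒n≤o N₃ _ rest≤n
        32≤L : 32 ≤ L
        32≤L = 32≤log n (m⊔n≤o⇒m≤o N₃ _ rest≤n)
        instance
          L≢0 : NonZero L
          L≢0 = >-nonZero (≤-trans (s≤s z≤n) 32≤L)
        k≤n : k n ≤ n
        k≤n = ≤-trans (m≤m*n (k n) (L ^ h n) {{m^n≢0 L (h n)}}) (small n N₁≤n)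
        2+exponent : 2 + exponent h n ≡ h n ⊓ loglog n
        2+exponent = m+[n∸m]≡n (⊓-glb (2≤h n N₂≤n) (≤-trans (m≤m+n 2 3) (2^≤⇒≤log 32≤L)))
        finish : ∀ k → k * L ^ h n ≤ n → n ≤ 8 * suc k * (L * c) → L ^ exponent h n ≤ c
        -- At `k = 0` the growth condition reads `0 ≤ n`, so the lower bound on `n` comes from the
        -- cap by `loglog n`. Here 1 stands in for `k`, and the factor 8 in `upper` is weakened to
        -- 16 accordingly.
        finish zero _ upper = cancel-log {g = exponent h n} 1 (≤-trans (m≤m+n 16 16) 32≤L) (begin
          1 * L ^ (2 + exponent h n)    ≡⟨ trans (*-identityˡ _) (cong (L ^_) 2+exponent) ⟩
          L ^ (h n ⊓ loglog n)          ≤⟨ ^-monoʳ-≤ L (m⊓n≤n (h n) (loglog n)) ⟩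
          L ^ loglog n                  ≤⟨ log^loglog≤ L 32≤L ⟩
          2 ^ L                         ≤⟨ 2^log≤n n (≤-trans (s≤s z≤n) 14≤n) ⟩
          n                             ∎)
          (≤-trans upper (*-monoˡ-≤ (L * c) (m≤m+n 8 8)))
        finish k@(suc _) small upper = cancel-log {g = exponent h n} k (≤-trans (m≤m+n 16 16) 32≤L) (begin
          k * L ^ (2 + exponent h n)    ≡⟨ cong (λ x → k * L ^ x) 2+exponent ⟩
          k * L ^ (h n ⊓ loglog n)      ≤⟨ *-monoʳ-≤ k (^-monoʳ-≤ L (m⊓n≤m (h n) (loglog n))) ⟩
          k * L ^ h n                   ≤⟨ small ⟩
          n                             ∎) upper
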